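{- Let $\sigma$ be a term ordering, let $F$ be a formula in 2-XNF, and let $G$ be an implication graph structure for $F$. Then the procedure $\mathrm{GGCP}$ (described in the context) is an algorithm, i.e. it terminates after finitely many steps, which returns a $\sigma$-reduced implication graph structure $G'=\mathrm{GGCP}_\sigma(G)$ for $F$ such that $G'\preceq G$.
   Context: $\mathbb{B}_n=\mathbb{F}_2[X_1,\dots,X_n]/\langle X_1^2-X_1,\dots,X_n^2-X_n\rangle$ is the ring of Boolean polynomials, $x_i$ the residue class of $X_i$, and $\mathbb{L}_n=\langle 1,x_1,\dots,x_n\rangle_{\mathbb{F}_2}$ the space of linear Boolean polynomials. $\mathrm{Supp}(f)$ is the set of square-free terms occurring in $f$. A term ordering $\sigma$ on $\mathbb{F}_2[X_1,\dots,X_n]$ induces an ordering on the square-free terms of $\mathbb{B}_n$, and $\mathrm{LT}_\sigma(f)$ is the largest term in $\mathrm{Supp}(f)$; $\mathrm{LT}_\sigma(L)$ is the set of leading terms of the elements of $L$. $\mathrm{NR}_\sigma(f,L)$ is the normal remainder of $f$ under the division algorithm by the elements of $L$ with respect to $\sigma$ (performed on the canonical square-free representatives). A lineral is an XOR of literals; a formula is in 2-XNF if it is a conjunction of clauses each of which is a disjunction of at most two linerals. For such a formula $F$ in the variables $X_1,\dots,X_n$ (true $=1$, false $=0$), $I_F\subseteq\mathbb{B}_n$ is the unique ideal whose zero set in $\mathbb{F}_2^n$ equals the set of satisfying assignments of $F$. An implication graph structure (IGS) for $F$ is a tuple $(L,V,E)$ with $L,V\subseteq\mathbb{L}_n$ and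 $E\subseteq V^2$ such that (1) $I_F=\langle L\rangle+\langle fg\mid (f+1,g)\in E\rangle$; (2) for all $(f+1,g)\in E$ we have $(g+1,f)\in E$; (3) for all $f\in V$, $(f,f)\notin E$. It is $\sigma$-reduced if the polynomials in $L$ have pairwise distinct leading terms and $\mathrm{LT}_\sigma(L)\cap\bigcup_{f\in V}\mathrm{Supp}(f)=\emptyset$. For two IGSs $G'=(L',V',E')$ and $G=(L,V,E)$ for $F$, $G'\preceq G$ means $\langle L'\rangle_{\mathbb{F}_2}\supseteq\langle L\rangle_{\mathbb{F}_2}$ and $\#V'\le\#V$. Procedure $\mathrm{GGCP}$, with input an IGS $G$ for $F$ and a term ordering $\sigma$: Line 1: Write $G=(L,V,E)$ and $\mathrm{LT}_\sigma$-interreduce $L$ (i.e. pass to a generating set of the same $\mathbb{F}_2$-span whose elements have pairwise distinct leading terms). Line 2: Let $(L',V',E')=(L,\emptyset,\emptyset)$. Lines 3-8: For each $(f,g)\in E$: let $f'=\mathrm{NR}_\sigma(f,L)$ and $g'=\mathrm{NR}_\sigma(g,L)$; if $f'=0$ and $g'\ne0$, append $g'$ to $L'$; if $g'=1$ and $f'\neq1$, append $f'+1$ to $L'$; if $f'\notin\mathbb{F}_2$ and $g'\notin\mathbb{F}_2$ and $f'\ne g'$, append $(f',g')$ to $E'$ and append $f'$ and $g'$ to $V'$. Line 9: If $L\ne L'$, set $(L,V,E)=(L',V',E')$ and go to Line 2. Line 10: Otherwise return $(L',V',E')$.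
   Formalization: In Line 9 the procedure jumps back to Line 1 (so L is LT-interreduced again before every pass) instead of Line 2; with the jump to Line 2 the returned structure need not be σ-reduced, e.g. it can contain L = {x1, x1+x2} with equal leading terms. -}

module Defs where

open import Level using (0ℓ)
open import Algebra.Bundles using (CommutativeRing)
import Algebra.Definitions.RawMonoid as RawMonoidDefs
import Algebra.Solver.Ring.NaturalCoefficients.Default as RingSolver
open import Data.Bool.Base using (Bool; true; false; not; _∧_; _∨_; _xor_; if_then_else_)
import Data.Bool.Properties as Bool
open import Data.Fin.Base using (Fin; zero; suc)
import Data.Fin.Properties as Fin
open import Data.List.Base using (List; []; _∷_; _++_; foldl; foldr; length; deduplicate; filter; mapMaybe; allFin; [_])
import Data.List.Extrema as Extrema
open import Data.List.Membership.Propositional using (_∈_)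
open import Data.List.Relation.Binary.BagAndSetEquality using (_∼[_]_; set)
open import Data.Maybe.Base using (Maybe; just; nothing)
open import Data.Nat.Base as ℕ using (ℕ; zero; suc)
open import Data.Product.Base using (_×_; _,_; ∃-syntax; proj₁; proj₂)
open import Data.Vec.Base using (Vec; []; _∷_; lookup; replicate; zipWith; _[_]≔_)
open import Data.Vec.Bounded.Base using (Vec≤; toList)
open import Data.Vec.Properties using (≡-dec)
open import Relation.Binary.Bundles using (TotalOrder)
open import Relation.Binary.Construct.Closure.ReflexiveTransitive using (Star)
open import Relation.Binary.Core using (Rel)
open import Relation.Binary.Definitions using (DecidableEquality)
open import Relation.Binary.PropositionalEquality using (_≡_; _≢_)
open import Relation.Binary.Structures using (IsTotalOrder)
open import Relation.Nullary using (¬_; ⌊_⌋; yes; no; ¬?; _×-dec_; _⊎-dec_)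
open import Relation.Unary using (Pred; _≐_; _⊆_)

-- The ring R[x]/⟨x² - x⟩.  The pair (g , h) is the class of g + h x, so
-- every class has exactly one representation, and
-- (g + h x) (g′ + h′ x) = g g′ + (g h′ + h g′ + h h′) x.
AdjoinIdempotent : CommutativeRing 0ℓ 0ℓ → CommutativeRing 0ℓ 0ℓ
AdjoinIdempotent R = record
  { Carrier = Carrier × Carrier
  ; _≈_ = λ { (g , h) (g′ , h′) → g ≈ g′ × h ≈ h′ }
  ; _+_ = λ { (g , h) (g′ , h′) → g + g′ , h + h′ }
  ; _*_ = λ { (g , h) (g′ , h′) → g * g′ , (g * h′ + h * g′) + h * h′ }
  ; -_  = λ { (g , h) → - g , - h }
  ; 0#  = 0# , 0#
  ; 1#  = 1# , 0#
  ; isCommutativeRing = record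
    { isRing = record
      { +-isAbelianGroup = record
        { isGroup = record
          { isMonoid = record
            { isSemigroup = record
              { isMagma = record
                { isEquivalence = record
                  { refl  = refl , refl
                  ; sym   = λ (p , q) → sym p , sym q
                  ; trans = λ (p , q) (p′ , q′) → trans p p′ , trans q q′
                  }
                ; ∙-cong = λ (p , q) (p′ , q′) → +-cong p p′ , +-cong q q′
                }
              ; assoc = λ (a , b) (c , d) (e , f) → +-assoc a c e , +-assoc b d f
              }
            ; identity = (λ (a , b) → +-identityˡ a , +-identityˡ b)
                       , (λ (a , b) → +-identityʳ a , +-identityʳ b)
            }
          ; inverse = (λ (a , b) → -‿inverseˡ a , -‿inverseˡ b)
                    , (λ (a , b) → -‿inverseʳ a , -‿inverseʳ b)
          ; ⁻¹-cong = λ (p , q) → -‿cong p , -‿cong q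
          }
        ; comm = λ (a , b) (c , d) → +-comm a c , +-comm b d
        }
      ; *-cong = λ (p , q) (p′ , q′) →
          *-cong p p′ , +-cong (+-cong (*-cong p q′) (*-cong q p′)) (*-cong q q′)
      ; *-assoc = λ (a , b) (c , d) (e , f) → *-assoc a c e ,
          solve 6 (λ a b c d e f →
            (a :* c) :* f :+ ((a :* d :+ b :* c) :+ b :* d) :* e
              :+ ((a :* d :+ b :* c) :+ b :* d) :* f
            := a :* ((c :* f :+ d :* e) :+ d :* f) :+ b :* (c :* e)
              :+ b :* ((c :* f :+ d :* e) :+ d :* f)) refl a b c d e f
      ; *-identity =
          (λ (a , b) → *-identityˡ a ,
            solve 2 (λ a b → (con 1 :* b :+ con 0 :* a) :+ con 0 :* b := b) refl a b)
        , (λ (a , b) → *-identityʳ a ,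
            solve 2 (λ a b → (a :* con 0 :+ b :* con 1) :+ b :* con 0 := b) refl a b)
      ; distrib =
          (λ (a , b) (c , d) (e , f) → distribˡ a c e ,
            solve 6 (λ a b c d e f →
              (a :* (d :+ f) :+ b :* (c :+ e)) :+ b :* (d :+ f)
              := ((a :* d :+ b :* c) :+ b :* d) :+ ((a :* f :+ b :* e) :+ b :* f))
              refl a b c d e f)
        , (λ (a , b) (c , d) (e , f) → distribʳ a c e ,
            solve 6 (λ a b c d e f →
              ((c :+ e) :* b :+ (d :+ f) :* a) :+ (d :+ f) :* b
              := ((c :* b :+ d :* a) :+ d :* b) :+ ((e :* b :+ f :* a) :+ f :* b))
              refl a b c d e f)
      }
    ; *-comm = λ (a , b) (c , d) → *-comm a c ,
        solve 4 (λ a b c d → (a :* d :+ b :* c) :+ b :* d := (c :* b :+ d :* a) :+ d :* b)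
          refl a b c d
    }
  }
  where
  open CommutativeRing R
  open RingSolver commutativeSemiring using (solve; _:=_; _:+_; _:*_; con)

-- 𝔹 n is 𝔽₂[X₁,…,Xₙ]/⟨X₁² - X₁,…,Xₙ² - Xₙ⟩, one indeterminate at a time.
𝔹 : ℕ → CommutativeRing 0ℓ 0ℓ
𝔹 zero    = Bool.xor-∧-commutativeRing
𝔹 (suc n) = AdjoinIdempotent (𝔹 n)

∣𝔹∣ : ℕ → Set
∣𝔹∣ n = CommutativeRing.Carrier (𝔹 n)

var : ∀ {n} → Fin n → ∣𝔹∣ n
var {suc n} zero    = CommutativeRing.0# (𝔹 n) , CommutativeRing.1# (𝔹 n)
var {suc n} (suc i) = var i , CommutativeRing.0# (𝔹 n)

Assignment : ℕ → Set
Assignment n = Vec Bool n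

eval : ∀ {n} → ∣𝔹∣ n → Assignment n → Bool
eval {zero}  b       []      = b
eval {suc n} (g , h) (a ∷ v) = eval g v xor (eval h v ∧ a)

module _ (R : CommutativeRing 0ℓ 0ℓ) where

  open CommutativeRing R

  record IsIdeal (I : Pred Carrier 0ℓ) : Set where
    field
      resp     : ∀ {f g} → f ≈ g → I f → I g
      0-closed : I 0#
      +-closed : ∀ {f g} → I f → I g → I (f + g)
      *-closed : ∀ f {g} → I g → I (f * g)

  data Generated (S : Pred Carrier 0ℓ) : Pred Carrier 0ℓ where
    gen      : ∀ {f} → S f → Generated S f
    resp     : ∀ {f g} → f ≈ g → Generated S f → Generated S g
    0-closed : Generated S 0#
    +-closed : ∀ {f g} → Generated S f → Generated S g → Generated S (f + g)
    *-closed : ∀ f {g} → Generated S g → Generated S (f * g)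

  IdealSum : Pred Carrier 0ℓ → Pred Carrier 0ℓ → Pred Carrier 0ℓ
  IdealSum I J h = ∃[ f ] ∃[ g ] I f × J g × h ≈ f + g

Zeros : ∀ {n} → Pred (∣𝔹∣ n) 0ℓ → Pred (Assignment n) 0ℓ
Zeros {n} I a = ∀ f → I f → eval {n} f a ≡ false

-- The terms 1, x₁, …, xₙ: index zero is 1, and suc i is the variable i.
𝕋 : ℕ → Set
𝕋 n = Fin (suc n)

-- Elements of ⟨1,x₁,…,xₙ⟩ by their coefficients, listed in the order of 𝕋 n.
𝕃 : ℕ → Set
𝕃 n = Vec Bool (suc n)

_≟_ : ∀ {n} → DecidableEquality (𝕃 n)
_≟_ = ≡-dec Bool._≟_

infixl 6 _⊕_
_⊕_ : ∀ {n} → 𝕃 n → 𝕃 n → 𝕃 n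
_⊕_ = zipWith _xor_

𝟘 : ∀ {n} → 𝕃 n
𝟘 = replicate _ false

term : ∀ {n} → 𝕋 n → 𝕃 n
term t = 𝟘 [ t ]≔ true

𝟙 : ∀ {n} → 𝕃 n
𝟙 = term zero

ι : ∀ {n} → 𝕃 n → ∣𝔹∣ n
ι {n} (c ∷ cs) =
  (if c then 1# else 0#) + sum {n} (λ i → if lookup cs i then var i else 0#)
  where
  open CommutativeRing (𝔹 n)
  open RawMonoidDefs +-rawMonoid using (sum)

infix 4 _∈Supp_
_∈Supp_ : ∀ {n} → 𝕋 n → 𝕃 n → Set
t ∈Supp f = lookup f t ≡ true

supp : ∀ {n} → 𝕃 n → List (𝕋 n)
supp f = filter (λ t → lookup f t Bool.≟ true) (allFin _)

data Span {n} (L : List (𝕃 n)) : Pred (𝕃 n) 0ℓ where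
  zero : Span L 𝟘
  add  : ∀ {l f} → l ∈ L → Span L f → Span L (l ⊕ f)

-- (i , b) is the literal Xᵢ for b = false and ¬Xᵢ for b = true.
Literal : ℕ → Set
Literal n = Fin n × Bool

Lineral : ℕ → Set
Lineral n = List (Literal n)

2-XNF : ℕ → Set
2-XNF n = List (Vec≤ (Lineral n) 2)

⟦_⟧lit : ∀ {n} → Literal n → Assignment n → Bool
⟦ i , b ⟧lit a = lookup a i xor b

⟦_⟧lin : ∀ {n} → Lineral n → Assignment n → Bool
⟦ ℓ ⟧lin a = foldr (λ p r → ⟦ p ⟧lit a xor r) false ℓ

⟦_⟧ : ∀ {n} → 2-XNF n → Assignment n → Bool
⟦ F ⟧ a = foldr (λ C r → foldr (λ ℓ s → ⟦ ℓ ⟧lin a ∨ s) false (toList C) ∧ r) true F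

Models : ∀ {n} → 2-XNF n → Pred (Assignment n) 0ℓ
Models F a = ⟦ F ⟧ a ≡ true

-- I_F is the only ideal satisfying this, by the Boolean Nullstellensatz.
record IsIdealOf {n} (F : 2-XNF n) (I : Pred (∣𝔹∣ n) 0ℓ) : Set where
  field
    isIdeal : IsIdeal (𝔹 n) I
    zeros   : Zeros {n} I ≐ Models F

-- A term of 𝔽₂[X₁,…,Xₙ] is given by its exponent vector.
record TermOrdering (n : ℕ) : Set₁ where
  field
    _≤_          : Rel (Vec ℕ n) 0ℓ
    isTotalOrder : IsTotalOrder _≡_ _≤_
    compatible   : ∀ {s t} u → s ≤ t → zipWith ℕ._+_ s u ≤ zipWith ℕ._+_ t u
    1-minimum    : ∀ t → replicate n 0 ≤ t

  totalOrder : TotalOrder 0ℓ 0ℓ 0ℓ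
  totalOrder = record { isTotalOrder = isTotalOrder }

exponents : ∀ {n} → 𝕋 n → Vec ℕ n
exponents zero    = replicate _ 0
exponents (suc i) = replicate _ 0 [ i ]≔ 1

module _ {n} (σ : TermOrdering n) where

  open Extrema (TermOrdering.totalOrder σ) using (argmax)

  LT : 𝕃 n → Maybe (𝕋 n)
  LT f with supp f
  ... | []     = nothing
  ... | t ∷ ts = just (argmax exponents t ts)

  -- The product (t / LT l) · l, provided that LT l divides t.  The only
  -- divisors of t among 1, x₁, …, xₙ are 1 and t; and if LT l is 1 then
  -- l = 1 because 1 is the smallest term, so that the product is t.
  multiple : 𝕋 n → 𝕃 n → Maybe (𝕃 n)
  multiple t l with LT l
  ... | nothing      = nothing
  ... | just zero    = just (term t)
  ... | just (suc i) = if ⌊ suc i Fin.≟ t ⌋ then just l else nothing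

  -- Division algorithm with current dividend v and partial remainder r;
  -- the first element of L with a suitable leading term is used.  LT v
  -- decreases with each step, so suc n steps reach v = 0.
  divide : ℕ → List (𝕃 n) → (v r : 𝕃 n) → 𝕃 n
  divide zero    L v r = r ⊕ v
  divide (suc k) L v r with LT v
  ... | nothing = r
  ... | just t with mapMaybe (multiple t) L
  ...   | []    = divide k L (v ⊕ term t) (r ⊕ term t)
  ...   | m ∷ _ = divide k L (v ⊕ m) r

  NR : 𝕃 n → List (𝕃 n) → 𝕃 n
  NR f L = divide (suc n) L f 𝟘

  DistinctLT : List (𝕃 n) → Set
  DistinctLT L = (∀ f → f ∈ L → f ≢ 𝟘)
               × (∀ f g → f ∈ L → g ∈ L → LT f ≡ LT g → f ≡ g)

  IsInterreductionOf : (L′ L : List (𝕃 n)) → Set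
  IsInterreductionOf L′ L = Span L′ ≐ Span L × DistinctLT L′

-- Lists stand for finite sets; order and repetitions are irrelevant.
record Graph (n : ℕ) : Set where
  constructor ⟨_,_,_⟩
  field
    L : List (𝕃 n)
    V : List (𝕃 n)
    E : List (𝕃 n × 𝕃 n)

open Graph public

linearPart : ∀ {n} → Graph n → Pred (∣𝔹∣ n) 0ℓ
linearPart G h = ∃[ l ] l ∈ L G × h ≡ ι l

edgePart : ∀ {n} → Graph n → Pred (∣𝔹∣ n) 0ℓ
edgePart {n} G h = ∃[ f ] ∃[ g ] (f ⊕ 𝟙 , g) ∈ E G × h ≡ CommutativeRing._*_ (𝔹 n) (ι f) (ι g)

record IsIGS {n} (I : Pred (∣𝔹∣ n) 0ℓ) (G : Graph n) : Set where
  field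
    E⊆V²           : ∀ f g → (f , g) ∈ E G → f ∈ V G × g ∈ V G
    represents     : I ≐ IdealSum (𝔹 n)
                           (Generated (𝔹 n) (linearPart G))
                           (Generated (𝔹 n) (edgePart G))
    contrapositive : ∀ f g → (f ⊕ 𝟙 , g) ∈ E G → (g ⊕ 𝟙 , f) ∈ E G
    loopless       : ∀ f → f ∈ V G → ¬ (f , f) ∈ E G

record IsReduced {n} (σ : TermOrdering n) (G : Graph n) : Set where
  field
    distinctLT : DistinctLT σ (L G)
    disjoint   : ∀ t l f → l ∈ L G → LT σ l ≡ just t → f ∈ V G → ¬ t ∈Supp f

#_ : ∀ {n} → List (𝕃 n) → ℕ
# W = length (deduplicate _≟_ W)

infix 4 _≼_
_≼_ : ∀ {n} → Graph n → Graph n → Set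
G′ ≼ G = Span (L G) ⊆ Span (L G′) × # (V G′) ℕ.≤ # (V G)

module _ {n} (σ : TermOrdering n) where

  -- L₀ is L as it was before the loop over the edges: remainders are not
  -- taken modulo the elements appended during the loop.
  processEdge : List (𝕃 n) → Graph n → 𝕃 n × 𝕃 n → Graph n
  processEdge L₀ ⟨ L′ , V′ , E′ ⟩ (f , g) =
    ⟨ (L′ ++ (if ⌊ f′ ≟ 𝟘 ×-dec ¬? (g′ ≟ 𝟘) ⌋ then [ g′ ] else []))
          ++ (if ⌊ g′ ≟ 𝟙 ×-dec ¬? (f′ ≟ 𝟙) ⌋ then [ f′ ⊕ 𝟙 ] else [])
    , V′ ++ (if keep then f′ ∷ g′ ∷ [] else [])
    , E′ ++ (if keep then [ (f′ , g′) ] else [])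
    ⟩
    where
    f′ = NR σ f L₀
    g′ = NR σ g L₀
    constant? = λ h → (h ≟ 𝟘) ⊎-dec (h ≟ 𝟙)
    keep = ⌊ ¬? (constant? f′) ×-dec ¬? (constant? g′) ×-dec ¬? (f′ ≟ g′) ⌋

  pass : Graph n → Graph n
  pass G = foldl (processEdge (L G)) ⟨ L G , [] , [] ⟩ (E G)

  data State : Set where
    interreduce : Graph n → State
    loop        : Graph n → State
    return      : Graph n → State

  -- Any interreduction of L is allowed.  It is repeated before every pass:
  -- the polynomials appended in one pass may share leading terms (such as
  -- x₁ and x₁ + x₂ for the edges (0 , x₁) and (0 , x₁ + x₂)), and a pass
  -- that appends nothing would return them as they are.
  infix 4 _⟶_
  data _⟶_ : Rel State 0ℓ where
    interreduced : ∀ {L₀ L₁ V₀ E₀} → IsInterreductionOf σ L₁ L₀ →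
                   interreduce ⟨ L₀ , V₀ , E₀ ⟩ ⟶ loop ⟨ L₁ , V₀ , E₀ ⟩
    changed      : ∀ {G} → ¬ (L G ∼[ set ] L (pass G)) →
                   loop G ⟶ interreduce (pass G)
    unchanged    : ∀ {G} → L G ∼[ set ] L (pass G) →
                   loop G ⟶ return (pass G)

  infix 4 _⟶*_
  _⟶*_ : Rel State 0ℓ
  _⟶*_ = Star _⟶_

-- A remainder modulo an interreduced L has no leading term of L in its support.  Hence each pass either
-- leaves L alone or enlarges the set of leading terms of its span, which can happen at most n + 1 times.
-- A pass preserves the represented ideal because (f + 1) g ≡ (f′ + 1) g′ modulo ⟨L⟩ for the remainders
-- f′, g′ of f, g, and (f′ + 1) g′ is 0 or one of the new linear generators unless the edge is kept.
-- Contraposition survives because NR (f + 1) = NR f + 1 as soon as 1 is irreducible; otherwise every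
-- remainder is 0 and no edge is left.

module Submission where

open import Defs
open import Level using (0ℓ)
open import Algebra.Bundles using (CommutativeRing; CommutativeSemigroup)
import Algebra.Properties.CommutativeMonoid.Sum as Sum
import Algebra.Properties.CommutativeSemigroup as CommutativeSemigroupProperties
open import Data.Bool.Base using (Bool; true; false; _xor_; if_then_else_)
import Data.Bool.Properties as Bool
open import Data.Empty using (⊥-elim)
open import Data.Fin.Base using (Fin; zero; suc)
import Data.Fin.Properties as Fin
open import Data.Fin.Subset using (Subset; ⊤; ∣_∣; _⊂_) renaming (_∈_ to _∈ₛ_)
import Data.Fin.Subset.Induction as Subset
import Data.Fin.Subset.Properties as Subset
open import Data.List.Base
  using (List; []; _∷_; _++_; [_]; allFin; concatMap; deduplicate; filter; foldl; length; map; mapMaybe)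
import Data.List.Extrema as Extrema
import Data.List.Membership.DecPropositional as DecMembership
open import Data.List.Membership.Propositional using (_∈_; _∉_; find; lose)
open import Data.List.Membership.Propositional.Properties
  using (∈-++⁺ˡ; ∈-++⁺ʳ; ∈-++⁻; ∈-allFin; ∈-concatMap⁺; ∈-concatMap⁻; ∈-deduplicate⁺; ∈-deduplicate⁻;
         ∈-filter⁺; ∈-filter⁻; ∈-map⁺)
open import Data.List.Properties using (++-assoc; ++-identityʳ; filter-notAll; length-map)
open import Data.List.Relation.Binary.BagAndSetEquality using (_∼[_]_; set)
import Data.List.Relation.Binary.Subset.Propositional as List
open import Data.List.Relation.Unary.All as All using (All)
open import Data.List.Relation.Unary.AllPairs using ([]; _∷_)
open import Data.List.Relation.Unary.Any as Any using (here; there; any?)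
open import Data.List.Relation.Unary.Any.Properties using (¬Any[])
open import Data.List.Relation.Unary.Unique.Propositional using (Unique)
import Data.List.Relation.Unary.Unique.DecPropositional.Properties as Unique
open import Data.Maybe.Base using (Maybe; just; nothing)
import Data.Maybe.Properties as Maybe
open import Data.Nat.Base as ℕ using (ℕ; zero; suc; z≤n; s≤s)
import Data.Nat.Properties as ℕ
open import Data.Product.Base using (_×_; _,_; ∃-syntax; proj₁; proj₂)
open import Data.Sum.Base using (_⊎_; inj₁; inj₂; [_,_]′)
open import Data.Vec.Base using (Vec; []; _∷_; lookup; replicate; tabulate; zipWith)
import Data.Vec.Properties as Vec
open import Function.Base using (flip; _∘_; id)
open import Function.Bundles using (Equivalence; mk⇔)
open import Induction.WellFounded using (Acc; acc)
open import Relation.Binary.Construct.Closure.ReflexiveTransitive using (ε; _◅_)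
open import Relation.Binary.PropositionalEquality
  using (_≡_; _≢_; refl; sym; trans; cong; cong₂; subst; isEquivalence; module ≡-Reasoning)
import Relation.Binary.Reasoning.Setoid as SetoidReasoning
open import Relation.Binary.Structures using (IsTotalOrder)
open import Relation.Nullary
  using (¬_; Dec; yes; no; ⌊_⌋; ¬?; _×-dec_; _⊎-dec_; contradiction; decidable-stable)
open import Relation.Unary using (Pred; Decidable; _≐_; _⊆_)

-- The obstacle is the polynomial 1. It divides every term, so if `L` contains 1, division subtracts
-- bare terms, and `f ⊕ NR σ f L` lies in the ideal of `L` but in general not in `Span L`. The
-- congruence of remainders is therefore proved once, for any predicate closed under sums, and used
-- twice: for an arbitrary ideal, where 1 makes everything a member, and for the span, provided that
-- 1 is irreducible. A kept edge supplies this proviso by itself, because its remainders are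
-- irreducible and nonzero.

-- Conditional lists, partial maps and decidable subsets of a finite set.

module _ {A : Set} where

  ∈-if⁺ : ∀ {P : Set} {xs : List A} {x} (P? : Dec P) → P → x ∈ xs →
          x ∈ (if ⌊ P? ⌋ then xs else [])
  ∈-if⁺ (yes _) _ x∈xs = x∈xs
  ∈-if⁺ (no ¬p) p _    = contradiction p ¬p

  ∈-if⁻ : ∀ {P : Set} {xs : List A} {x} (P? : Dec P) →
          x ∈ (if ⌊ P? ⌋ then xs else []) → P × x ∈ xs
  ∈-if⁻ (yes p) x∈xs = p , x∈xs
  ∈-if⁻ (no _)  ()

  mapMaybe≡[] : ∀ {B : Set} {f : A → Maybe B} xs {x} →
                mapMaybe f xs ≡ [] → x ∈ xs → f x ≡ nothing
  mapMaybe≡[] {f = f} (y ∷ ys) eq x∈xs with f y in fy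
  mapMaybe≡[] (y ∷ ys) () _            | just _
  mapMaybe≡[] (y ∷ ys) eq (here refl)  | nothing = fy
  mapMaybe≡[] (y ∷ ys) eq (there x∈xs) | nothing = mapMaybe≡[] ys eq x∈xs

  mapMaybe≡∷ : ∀ {B : Set} {f : A → Maybe B} xs {y ys} →
               mapMaybe f xs ≡ y ∷ ys → ∃[ x ] x ∈ xs × f x ≡ just y
  mapMaybe≡∷ {f = f} (x ∷ xs) eq with f x in fx
  mapMaybe≡∷ (x ∷ xs) refl | just _ = _ , here refl , fx
  mapMaybe≡∷ (x ∷ xs) eq   | nothing with mapMaybe≡∷ xs eq
  ... | z , x∈xs , fx≡y = z , there x∈xs , fx≡y

module _ {n : ℕ} where

  -- Encoded as a `Subset` to inherit cardinalities, for `rank`, and well-founded strict inclusion,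
  -- for termination.
  subset : ∀ {P : Pred (Fin n) 0ℓ} → Decidable P → Subset n
  subset P? = tabulate (λ i → ⌊ P? i ⌋)

  module _ {P : Pred (Fin n) 0ℓ} (P? : Decidable P) where

    ∈-subset⁺ : ∀ {i} → P i → i ∈ₛ subset P?
    ∈-subset⁺ {i} p = Vec.lookup⇒[]= i _ (trans (Vec.lookup∘tabulate _ i) (helper (P? i)))
      where
      helper : (d : Dec (P i)) → ⌊ d ⌋ ≡ true
      helper (yes _) = refl
      helper (no ¬p) = contradiction p ¬p

    ∈-subset⁻ : ∀ {i} → i ∈ₛ subset P? → P i
    ∈-subset⁻ {i} i∈ = helper (P? i) (trans (sym (Vec.lookup∘tabulate _ i)) (Vec.[]=⇒lookup i∈))
      where
      helper : (d : Dec (P i)) → ⌊ d ⌋ ≡ true → P i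
      helper (yes p) _ = p

  subset-⊂ : ∀ {P Q : Pred (Fin n) 0ℓ} (P? : Decidable P) (Q? : Decidable Q) →
             P ⊆ Q → ∀ {i} → Q i → ¬ P i → subset P? ⊂ subset Q?
  subset-⊂ P? Q? P⊆Q q ¬p =
    ∈-subset⁺ Q? ∘ P⊆Q ∘ ∈-subset⁻ P? , _ , ∈-subset⁺ Q? q , ¬p ∘ ∈-subset⁻ P?

-- Linear polynomials over 𝔽₂: addition, supports, spans, counting.

module _ {n : ℕ} where

  ⊕-assoc : (f g h : 𝕃 n) → (f ⊕ g) ⊕ h ≡ f ⊕ (g ⊕ h)
  ⊕-assoc = Vec.zipWith-assoc Bool.xor-assoc

  ⊕-comm : (f g : 𝕃 n) → f ⊕ g ≡ g ⊕ f
  ⊕-comm = Vec.zipWith-comm Bool.xor-comm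

  ⊕-identityˡ : (f : 𝕃 n) → 𝟘 ⊕ f ≡ f
  ⊕-identityˡ = Vec.zipWith-identityˡ Bool.xor-identityˡ

  ⊕-identityʳ : (f : 𝕃 n) → f ⊕ 𝟘 ≡ f
  ⊕-identityʳ = Vec.zipWith-identityʳ Bool.xor-identityʳ

  ⊕-self : (f : 𝕃 n) → f ⊕ f ≡ 𝟘
  ⊕-self f = trans (cong (_⊕ f) (sym (Vec.map-id f))) (Vec.zipWith-inverseˡ Bool.xor-same f)

  ⊕-cancelˡ : (f g : 𝕃 n) → f ⊕ (f ⊕ g) ≡ g
  ⊕-cancelˡ f g = trans (sym (⊕-assoc f f g)) (trans (cong (_⊕ g) (⊕-self f)) (⊕-identityˡ g))

  ⊕-cancelʳ : (f g : 𝕃 n) → (f ⊕ g) ⊕ g ≡ f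
  ⊕-cancelʳ f g = trans (⊕-assoc f g g) (trans (cong (f ⊕_) (⊕-self g)) (⊕-identityʳ f))

  ⊕≡𝟘⇒≡ : {f g : 𝕃 n} → f ⊕ g ≡ 𝟘 → f ≡ g
  ⊕≡𝟘⇒≡ {f} {g} eq = trans (sym (⊕-cancelʳ f g)) (trans (cong (_⊕ g) eq) (⊕-identityˡ g))

  ⊕-commutativeSemigroup : CommutativeSemigroup 0ℓ 0ℓ
  ⊕-commutativeSemigroup = record
    { _∙_ = _⊕_ {n}
    ; isCommutativeSemigroup = record
      { isSemigroup = record
        { isMagma = record { isEquivalence = isEquivalence ; ∙-cong = cong₂ _⊕_ }
        ; assoc   = ⊕-assoc
        }
      ; comm = ⊕-comm
      }
    }

  open CommutativeSemigroupProperties ⊕-commutativeSemigroup public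
    using () renaming (interchange to ⊕-interchange; xy∙z≈xz∙y to ⊕-swapʳ)

  lookup-⊕ : ∀ (t : 𝕋 n) f g → lookup (f ⊕ g) t ≡ lookup f t xor lookup g t
  lookup-⊕ = Vec.lookup-zipWith _xor_

  ∈Supp-⊕ : ∀ t (f g : 𝕃 n) → t ∈Supp f ⊕ g → t ∈Supp f ⊎ t ∈Supp g
  ∈Supp-⊕ t f g t∈ with lookup f t | lookup g t | lookup-⊕ t f g
  ... | true  | _     | _  = inj₁ refl
  ... | false | true  | _  = inj₂ refl
  ... | false | false | eq = contradiction (trans (sym t∈) eq) λ ()

  ∈Supp-⊕⁺ : ∀ t (f g : 𝕃 n) → t ∈Supp f → ¬ t ∈Supp g → t ∈Supp f ⊕ g
  ∈Supp-⊕⁺ t f g t∈f t∉g with lookup f t | lookup g t | lookup-⊕ t f g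
  ∈Supp-⊕⁺ t f g refl t∉g | _ | true  | _  = contradiction refl t∉g
  ∈Supp-⊕⁺ t f g refl t∉g | _ | false | eq = eq

  ∉Supp-⊕ : ∀ t (f g : 𝕃 n) → t ∈Supp f → t ∈Supp g → ¬ t ∈Supp f ⊕ g
  ∉Supp-⊕ t f g t∈f t∈g t∈ with trans (sym t∈) (trans (lookup-⊕ t f g) (cong₂ _xor_ t∈f t∈g))
  ... | ()

  ∉Supp-𝟘 : ∀ (t : 𝕋 n) → ¬ t ∈Supp 𝟘
  ∉Supp-𝟘 t t∈ with trans (sym t∈) (Vec.lookup-replicate t false)
  ... | ()

  ∈Supp-term : ∀ (t : 𝕋 n) → t ∈Supp term t
  ∈Supp-term t = Vec.lookup∘update t 𝟘 true

  ∈Supp-term⁻ : ∀ {s} (t : 𝕋 n) → s ∈Supp term t → s ≡ t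
  ∈Supp-term⁻ {s} t s∈ with s Fin.≟ t
  ... | yes s≡t = s≡t
  ... | no  s≢t = contradiction (trans (sym (Vec.lookup∘update′ s≢t 𝟘 true)) s∈) (∉Supp-𝟘 s)

  Supp-empty : (f : 𝕃 n) → (∀ t → ¬ t ∈Supp f) → f ≡ 𝟘
  Supp-empty f ∉f = trans (sym (Vec.tabulate∘lookup f))
    (trans (Vec.tabulate-cong (λ t → trans (Bool.¬-not (∉f t)) (sym (Vec.lookup-replicate t false))))
      (Vec.tabulate∘lookup 𝟘))

  open DecMembership (_≟_ {n}) public using (_∈?_)

  ∈⇒Span : {L : List (𝕃 n)} {l : 𝕃 n} → l ∈ L → Span L l
  ∈⇒Span {L} {l} l∈L = subst (Span L) (⊕-identityʳ l) (add l∈L zero)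

  Span-⊕ : ∀ {L} {f g : 𝕃 n} → Span L f → Span L g → Span L (f ⊕ g)
  Span-⊕ {L} zero g∈ = subst (Span L) (sym (⊕-identityˡ _)) g∈
  Span-⊕ {L} (add l∈L f∈) g∈ = subst (Span L) (sym (⊕-assoc _ _ _)) (add l∈L (Span-⊕ f∈ g∈))

  Span-least : ∀ {L} {P : Pred (𝕃 n) 0ℓ} → P 𝟘 → (∀ {f g} → P f → P g → P (f ⊕ g)) →
               (∀ {l} → l ∈ L → P l) → Span L ⊆ P
  Span-least P-𝟘 P-⊕ P-L zero         = P-𝟘
  Span-least P-𝟘 P-⊕ P-L (add l∈L f∈) = P-⊕ (P-L l∈L) (Span-least P-𝟘 P-⊕ P-L f∈)

  Span-mono : ∀ {L L′ : List (𝕃 n)} → (∀ {l} → l ∈ L → Span L′ l) → Span L ⊆ Span L′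
  Span-mono = Span-least zero Span-⊕

  -- Over 𝔽₂ only the parity of the number of uses of `l` matters.
  Span-∷⁻ : ∀ {l L} {f : 𝕃 n} → Span (l ∷ L) f → Span L f ⊎ Span L (l ⊕ f)
  Span-∷⁻ zero = inj₁ zero
  Span-∷⁻ {l} {L} (add (here refl) f∈) with Span-∷⁻ f∈
  ... | inj₁ f∈′ = inj₂ (subst (Span L) (sym (⊕-cancelˡ l _)) f∈′)
  ... | inj₂ f∈′ = inj₁ f∈′
  Span-∷⁻ {l} {L} (add {k} {f} (there k∈L) f∈) with Span-∷⁻ f∈
  ... | inj₁ f∈′ = inj₁ (add k∈L f∈′)
  ... | inj₂ f∈′ = inj₂ (subst (Span L) lemma (add k∈L f∈′))
    where
    lemma : k ⊕ (l ⊕ f) ≡ l ⊕ (k ⊕ f)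
    lemma = trans (sym (⊕-assoc k l f)) (trans (cong (_⊕ f) (⊕-comm k l)) (⊕-assoc l k f))

  -- Deleting every copy of `x` shortens `ys` by at least one and keeps the rest of `xs`, which
  -- avoids `x`.
  Unique-length : ∀ {xs ys : List (𝕃 n)} → Unique xs → xs List.⊆ ys → length xs ℕ.≤ length ys
  Unique-length [] _ = z≤n
  Unique-length {x ∷ xs} {ys} (x∉xs ∷ u) ⊆ys = ℕ.≤-trans (s≤s (Unique-length u ⊆rest))
    (filter-notAll (λ y → ¬? (x ≟ y)) ys (Any.map (λ x≡y x≢y → x≢y x≡y) (⊆ys (here refl))))
    where
    ⊆rest : xs List.⊆ filter (λ y → ¬? (x ≟ y)) ys
    ⊆rest z∈xs = ∈-filter⁺ (λ y → ¬? (x ≟ y)) (⊆ys (there z∈xs)) (All.lookup x∉xs z∈xs)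

  #-image : (h : 𝕃 n → 𝕃 n) {V W : List (𝕃 n)} → (∀ {w} → w ∈ W → ∃[ v ] v ∈ V × w ≡ h v) → # W ℕ.≤ # V
  #-image h {V} {W} W⊆hV = ℕ.≤-trans
    (Unique-length {ys = map h (deduplicate _≟_ V)} (Unique.deduplicate-! _≟_ W) ⊆image)
    (ℕ.≤-reflexive (length-map h (deduplicate _≟_ V)))
    where
    ⊆image : deduplicate _≟_ W List.⊆ map h (deduplicate _≟_ V)
    ⊆image w∈ with W⊆hV (∈-deduplicate⁻ _≟_ W w∈)
    ... | v , v∈V , refl = ∈-map⁺ h (∈-deduplicate⁺ _≟_ v∈V)

-- Term orderings, leading terms and irreducibility.

exponents-injective : ∀ {n} {s t : 𝕋 n} → exponents s ≡ exponents t → s ≡ t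
exponents-injective {s = zero}  {zero}  _  = refl
exponents-injective {s = zero}  {suc j} eq
  with trans (sym (Vec.lookup-replicate j 0))
         (trans (cong (λ v → lookup v j) eq) (Vec.lookup∘update j (replicate _ 0) 1))
... | ()
exponents-injective {s = suc i} {zero}  eq
  with trans (sym (Vec.lookup∘update i (replicate _ 0) 1))
         (trans (cong (λ v → lookup v i) eq) (Vec.lookup-replicate i 0))
... | ()
exponents-injective {s = suc i} {suc j} eq with i Fin.≟ j
... | yes refl = refl
... | no  i≢j
  with trans (sym (Vec.lookup∘update i (replicate _ 0) 1))
         (trans (cong (λ v → lookup v i) eq)
           (trans (Vec.lookup∘update′ i≢j (replicate _ 0) 1) (Vec.lookup-replicate i 0)))
...   | ()

module _ {n} (σ : TermOrdering n) where

  private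
    module ≤ = IsTotalOrder (TermOrdering.isTotalOrder σ)
  open TermOrdering σ using (_≤_)
  open Extrema (TermOrdering.totalOrder σ) using (argmax; argmax-all; f[⊥]≤f[argmax]; f[xs]≤f[argmax])

  infix 4 _⊴_
  _⊴_ : 𝕋 n → 𝕋 n → Set
  s ⊴ t = exponents s ≤ exponents t

  ⊴-antisym : ∀ {s t} → s ⊴ t → t ⊴ s → s ≡ t
  ⊴-antisym s⊴t t⊴s = exponents-injective (≤.antisym s⊴t t⊴s)

  -- A term ordering carries no decision procedure; totality together with antisymmetry yields one.
  _⊴?_ : ∀ s t → Dec (s ⊴ t)
  s ⊴? t with ≤.total (exponents s) (exponents t)
  ... | inj₁ s⊴t = yes s⊴t
  ... | inj₂ t⊴s with s Fin.≟ t
  ...   | yes refl = yes ≤.refl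
  ...   | no  s≢t  = no λ s⊴t → s≢t (⊴-antisym s⊴t t⊴s)

  below? : ∀ t → Decidable (λ s → s ⊴ t × s ≢ t)
  below? t s = (s ⊴? t) ×-dec ¬? (s Fin.≟ t)

  -- The position of `t` in the ordering, which turns the descent of leading terms into a bound on
  -- the fuel of `divide`.
  rank : 𝕋 n → ℕ
  rank t = ∣ subset (below? t) ∣

  rank-mono : ∀ {s t} → s ⊴ t → s ≢ t → rank s ℕ.< rank t
  rank-mono {s} {t} s⊴t s≢t = Subset.p⊂q⇒∣p∣<∣q∣ (subset-⊂ (below? s) (below? t)
    (λ (r⊴s , r≢s) → ≤.trans r⊴s s⊴t , λ { refl → r≢s (⊴-antisym r⊴s s⊴t) })
    (s⊴t , s≢t) (λ (_ , s≢s) → s≢s refl))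

  rank-bound : ∀ t → rank t ℕ.< suc n
  rank-bound t = ℕ.<-≤-trans (Subset.p⊂q⇒∣p∣<∣q∣ {q = ⊤}
    (Subset.⊆⊤ , t , Subset.∈⊤ , λ t∈ → proj₂ (∈-subset⁻ (below? t) t∈) refl)) (Subset.∣p∣≤n ⊤)

  record IsLead (f : 𝕃 n) (t : 𝕋 n) : Set where
    constructor isLead
    field
      ∈-Supp  : t ∈Supp f
      maximal : ∀ {s} → s ∈Supp f → s ⊴ t

  open IsLead

  LT-nothing : ∀ f → LT σ f ≡ nothing → f ≡ 𝟘
  LT-nothing f eq with supp f in supp≡
  LT-nothing f eq | [] = Supp-empty f λ t t∈ →
    ¬Any[] (subst (t ∈_) supp≡ (∈-filter⁺ (λ t → lookup f t Bool.≟ true) (∈-allFin t) t∈))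

  LT-just : ∀ f {t} → LT σ f ≡ just t → IsLead f t
  LT-just f eq with supp f in supp≡
  LT-just f refl | t ∷ ts = isLead
    (argmax-all exponents (∈supp⁻ (here refl)) (All.tabulate (λ s∈ → ∈supp⁻ (there s∈))))
    bound
    where
    ∈supp⁻ : ∀ {s} → s ∈ t ∷ ts → s ∈Supp f
    ∈supp⁻ s∈ = proj₂ (∈-filter⁻ (λ t → lookup f t Bool.≟ true) {xs = allFin _} (subst (_ ∈_) (sym supp≡) s∈))
    bound : ∀ {s} → s ∈Supp f → s ⊴ argmax exponents t ts
    bound s∈f with subst (_ ∈_) supp≡ (∈-filter⁺ (λ t → lookup f t Bool.≟ true) (∈-allFin _) s∈f)
    ... | here refl  = f[⊥]≤f[argmax] {f = exponents} t ts
    ... | there s∈ts = All.lookup (f[xs]≤f[argmax] {f = exponents} t ts) s∈ts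

  IsLead-unique : ∀ {f s t} → IsLead f s → IsLead f t → s ≡ t
  IsLead-unique p q = ⊴-antisym (maximal q (∈-Supp p)) (maximal p (∈-Supp q))

  IsLead⇒LT : ∀ f {t} → IsLead f t → LT σ f ≡ just t
  IsLead⇒LT f {t} p with LT σ f in eq
  ... | just s  = cong just (IsLead-unique (LT-just f eq) p)
  ... | nothing = contradiction (subst (t ∈Supp_) (LT-nothing f eq) (∈-Supp p)) (∉Supp-𝟘 t)

  LT-defined : ∀ {f} → f ≢ 𝟘 → ∃[ t ] LT σ f ≡ just t
  LT-defined {f} f≢𝟘 with LT σ f in eq
  ... | just t  = t , refl
  ... | nothing = contradiction (LT-nothing f eq) f≢𝟘

  IsLead-⊕ : ∀ {f g s t} → IsLead f s → IsLead g t → t ⊴ s → t ≢ s → IsLead (f ⊕ g) s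
  IsLead-⊕ {f} {g} {s} p q t⊴s t≢s = isLead
    (∈Supp-⊕⁺ s f g (∈-Supp p) (λ s∈g → t≢s (⊴-antisym t⊴s (maximal q s∈g))))
    (λ r∈ → [ maximal p , (λ r∈g → ≤.trans (maximal q r∈g) t⊴s) ]′ (∈Supp-⊕ _ f g r∈))

  IsLead-term : ∀ t → IsLead (term t) t
  IsLead-term t = isLead (∈Supp-term t) λ s∈ → subst (_⊴ t) (sym (∈Supp-term⁻ t s∈)) ≤.refl

  IsLead-zero⇒≡𝟙 : ∀ {f} → IsLead f zero → f ≡ 𝟙
  IsLead-zero⇒≡𝟙 {f} p = ⊕≡𝟘⇒≡ (Supp-empty (f ⊕ 𝟙) λ t t∈ →
    [ (λ t∈f → ∉ t (⊴-antisym (maximal p t∈f) (TermOrdering.1-minimum σ _)) t∈)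
    , (λ t∈𝟙 → ∉ t (∈Supp-term⁻ {s = t} zero t∈𝟙) t∈) ]′ (∈Supp-⊕ t f 𝟙 t∈))
    where
    ∉ : ∀ t → t ≡ zero → ¬ t ∈Supp f ⊕ 𝟙
    ∉ t refl = ∉Supp-⊕ zero f 𝟙 (∈-Supp p) refl

  multiple-just : ∀ {t l m} → multiple σ t l ≡ just m →
                  (l ≡ 𝟙 × m ≡ term t) ⊎ (LT σ l ≡ just t × m ≡ l)
  multiple-just {t} {l} eq with LT σ l in lt
  multiple-just {t} {l} refl | just zero = inj₁ (IsLead-zero⇒≡𝟙 (LT-just l lt) , refl)
  multiple-just {t} eq   | just (suc i) with suc i Fin.≟ t
  multiple-just refl | just (suc i) | yes refl = inj₂ (refl , refl)

  IsLead-multiple : ∀ {t l m} → multiple σ t l ≡ just m → IsLead m t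
  IsLead-multiple {t} {l} eq with multiple-just {t} {l} eq
  ... | inj₁ (_ , refl)  = IsLead-term t
  ... | inj₂ (lt , refl) = LT-just l lt

  multiple-nothing : ∀ {t l} → multiple σ t l ≡ nothing → LT σ l ≢ just t
  multiple-nothing {t} {l} eq lt with LT σ l
  multiple-nothing {suc i} eq refl | just (suc i) with i Fin.≟ i
  multiple-nothing {suc i} () refl | just (suc i) | yes _
  ... | no i≢i = i≢i refl

  -- Only an element with leading term 1 can divide 1, and such an element divides every term.
  multiple-nothing-𝟙 : ∀ {t l} → multiple σ t l ≡ nothing → multiple σ zero l ≡ nothing
  multiple-nothing-𝟙 {t} {l} eq with LT σ l
  ... | nothing      = refl
  ... | just (suc i) = refl

  -- Stated through `multiple`, hence stronger than avoiding the leading terms of `L`: if `𝟙 ∈ L`,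
  -- only `𝟘` is irreducible.
  Irreducible : List (𝕃 n) → 𝕃 n → Set
  Irreducible L f = ∀ {t l} → t ∈Supp f → l ∈ L → multiple σ t l ≡ nothing

  module _ {L : List (𝕃 n)} where

    irreducible-𝟘 : Irreducible L 𝟘
    irreducible-𝟘 {t} t∈ _ = contradiction t∈ (∉Supp-𝟘 t)

    irreducible-⊕ : ∀ f g → Irreducible L f → Irreducible L g → Irreducible L (f ⊕ g)
    irreducible-⊕ f g p q t∈ l∈L = [ (λ t∈f → p t∈f l∈L) , (λ t∈g → q t∈g l∈L) ]′ (∈Supp-⊕ _ f g t∈)

    irreducible-𝟙 : ∀ f → Irreducible L f → f ≢ 𝟘 → Irreducible L 𝟙
    irreducible-𝟙 f p f≢𝟘 {t} {l} t∈ l∈L with ∈Supp-term⁻ {s = t} zero t∈ | LT-defined f≢𝟘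
    ... | refl | s , lt = multiple-nothing-𝟙 {s} {l} (p (∈-Supp (LT-just f lt)) l∈L)

    irreducible-LT : ∀ f {t} → Irreducible L f → LT σ f ≡ just t → ∀ {l} → l ∈ L → LT σ l ≢ just t
    irreducible-LT f p lt {l} l∈L = multiple-nothing {_} {l} (p (∈-Supp (LT-just f lt)) l∈L)

  -- Vacuous for `𝟘`, and for `k = 0` it forces `f ≡ 𝟘`; so it says that `k` steps suffice to divide
  -- `f`.
  Below : ℕ → 𝕃 n → Set
  Below k f = ∀ {t} → LT σ f ≡ just t → rank t ℕ.< k

  below-𝕃 : ∀ f → Below (suc n) f
  below-𝕃 f _ = rank-bound _

  -- The common leading term cancels, and every other term of either summand is smaller.
  below-⊕ : ∀ {k f g t} → Below (suc k) f → LT σ f ≡ just t → IsLead g t → Below k (f ⊕ g)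
  below-⊕ {k} {f} {g} {t} below lt q {s} lt′ =
    ℕ.<-≤-trans (rank-mono s⊴t s≢t) (ℕ.s≤s⁻¹ (below lt))
    where
    p = LT-just f lt
    s∈ = ∈-Supp (LT-just (f ⊕ g) lt′)
    s⊴t : s ⊴ t
    s⊴t = [ maximal p , maximal q ]′ (∈Supp-⊕ s f g s∈)
    s≢t : s ≢ t
    s≢t refl = ∉Supp-⊕ s f g (∈-Supp p) (∈-Supp q) s∈

  -- Division: irreducibility, congruence and uniqueness of remainders.

  divide-irreducible : ∀ k L v r → Below k v → Irreducible L r → Irreducible L (divide σ k L v r)
  divide-irreducible zero L v r below p with LT σ v in lt
  -- Without fuel, `Below` leaves only `v ≡ 𝟘`, so that the returned `r ⊕ v` is `r`.
  ... | just t  = contradiction (below refl) λ ()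
  ... | nothing rewrite LT-nothing v lt | ⊕-identityʳ r = p
  divide-irreducible (suc k) L v r below p with LT σ v in lt
  ... | nothing = p
  ... | just t with mapMaybe (multiple σ t) L in ms
  -- Nothing in `L` divides `t` here, which is why the term moved to the remainder is irreducible.
  ...   | [] = divide-irreducible k L _ _
                 (below-⊕ {f = v} (λ e → below (trans (sym lt) e)) lt (IsLead-term t))
                 (irreducible-⊕ r (term t) p λ {_} {l} s∈ l∈L →
                   subst (λ s → multiple σ s l ≡ nothing) (sym (∈Supp-term⁻ t s∈)) (mapMaybe≡[] L ms l∈L))
  ...   | m ∷ _ with mapMaybe≡∷ L ms
  ...     | l , _ , eq = divide-irreducible k L _ _
                           (below-⊕ {f = v} (λ e → below (trans (sym lt) e)) lt (IsLead-multiple {l = l} eq)) p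

  NR-irreducible : ∀ f L → Irreducible L (NR σ f L)
  NR-irreducible f L = divide-irreducible (suc n) L f 𝟘 (below-𝕃 f) irreducible-𝟘

  module _ {P : Pred (𝕃 n) 0ℓ} (P-𝟘 : P 𝟘) (P-⊕ : ∀ {f g} → P f → P g → P (f ⊕ g)) {L : List (𝕃 n)}
           (P-multiple : ∀ {t l m} → l ∈ L → multiple σ t l ≡ just m → P m) where

    -- Moving a term from `v` to `r` preserves `v ⊕ r`, and a division step changes it by a multiple
    -- satisfying `P`. The abstract `P` stands for the span of `L` or for membership in an ideal.
    divide-mod : ∀ k v r → P (divide σ k L v r ⊕ (v ⊕ r))
    divide-mod zero v r = subst P (sym (trans (cong (_⊕ (v ⊕ r)) (⊕-comm r v)) (⊕-self (v ⊕ r)))) P-𝟘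
    divide-mod (suc k) v r with LT σ v in lt
    ... | nothing rewrite LT-nothing v lt = subst P (sym (trans (cong (r ⊕_) (⊕-identityˡ r)) (⊕-self r))) P-𝟘
    ... | just t with mapMaybe (multiple σ t) L in ms
    ...   | [] = subst (λ w → P (divide σ k L (v ⊕ m) (r ⊕ m) ⊕ w)) eq (divide-mod k (v ⊕ m) (r ⊕ m))
      where
      m = term t
      eq : (v ⊕ m) ⊕ (r ⊕ m) ≡ v ⊕ r
      eq = trans (⊕-interchange v m r m) (trans (cong ((v ⊕ r) ⊕_) (⊕-self m)) (⊕-identityʳ (v ⊕ r)))
    ...   | m ∷ _ with mapMaybe≡∷ L ms
    ...     | l , l∈L , mult = subst P eq (P-⊕ (divide-mod k (v ⊕ m) r) (P-multiple l∈L mult))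
      where
      D = divide σ k L (v ⊕ m) r
      eq : (D ⊕ ((v ⊕ m) ⊕ r)) ⊕ m ≡ D ⊕ (v ⊕ r)
      eq = trans (⊕-assoc D _ m) (cong (D ⊕_) (trans (cong (_⊕ m) (⊕-swapʳ v m r)) (⊕-cancelʳ (v ⊕ r) m)))

    NR-mod : ∀ f → P (f ⊕ NR σ f L)
    NR-mod f = subst P (trans (⊕-comm _ _) (cong (_⊕ NR σ f L) (⊕-identityʳ f))) (divide-mod (suc n) f 𝟘)

  DistinctLT-tail : ∀ {l L} → DistinctLT σ (l ∷ L) → DistinctLT σ L
  DistinctLT-tail (nonzero , distinct) =
    (λ f f∈ → nonzero f (there f∈)) , (λ f g f∈ g∈ → distinct f g (there f∈) (there g∈))

  -- Leading terms of distinct elements never cancel, so the largest one involved survives.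
  LT-Span : ∀ L → DistinctLT σ L → ∀ {f t} → Span L f → LT σ f ≡ just t → ∃[ l ] l ∈ L × LT σ l ≡ just t
  LT-Span [] _ {t = t} zero lt = contradiction (∈-Supp (LT-just 𝟘 lt)) (∉Supp-𝟘 t)
  LT-Span (l ∷ L) d {f} {t} f∈ lt with LT-Span L (DistinctLT-tail d)
  ... | IH with Span-∷⁻ f∈
  ...   | inj₁ f∈L = let k , k∈L , eq = IH f∈L lt in k , there k∈L , eq
  ...   | inj₂ lf∈L with l ∈? L
  -- `DistinctLT` concerns membership, not positions, so `l` may recur in `L`; then `f` already lies
  -- in `Span L`.
  ...     | yes l∈L =
    let k , k∈L , eq = IH (subst (Span L) (⊕-cancelˡ l f) (add l∈L lf∈L)) lt in k , there k∈L , eq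
  ...     | no  l∉L with LT σ (l ⊕ f) in lt-lf
  ...       | nothing = l , here refl , trans (cong (LT σ) (⊕≡𝟘⇒≡ (LT-nothing (l ⊕ f) lt-lf))) lt
  ...       | just s with IH lf∈L lt-lf | LT-defined (proj₁ d l (here refl))
  ...         | k , k∈L , lt-k | u , lt-l = compare
    where
    -- `f = l ⊕ (l ⊕ f)` has summands with leading terms `u` and `s`; if these agreed, distinctness
    -- would identify `l` with `k ∈ L`.
    s≢u : s ≢ u
    s≢u refl = l∉L (subst (_∈ L) (proj₂ d k l (there k∈L) (here refl) (trans lt-k (sym lt-l))) k∈L)
    f-lead : ∀ {v} → IsLead (l ⊕ (l ⊕ f)) v → v ≡ t
    f-lead p = IsLead-unique (subst (λ h → IsLead h _) (⊕-cancelˡ l f) p) (LT-just f lt)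
    compare : ∃[ k ] k ∈ l ∷ L × LT σ k ≡ just t
    compare with ≤.total (exponents s) (exponents u)
    ... | inj₁ s⊴u = l , here refl ,
      trans lt-l (cong just (f-lead (IsLead-⊕ (LT-just l lt-l) (LT-just (l ⊕ f) lt-lf) s⊴u s≢u)))
    ... | inj₂ u⊴s = k , there k∈L ,
      trans lt-k (cong just (f-lead (subst (λ h → IsLead h s) (⊕-comm (l ⊕ f) l)
        (IsLead-⊕ (LT-just (l ⊕ f) lt-lf) (LT-just l lt-l) u⊴s (s≢u ∘ sym)))))

  module _ {L} (d : DistinctLT σ L) where

    -- A nonzero difference would be irreducible, yet its leading term, as one of the span, is that
    -- of some element of `L`.
    irreducible-unique : ∀ {f g} → Irreducible L f → Irreducible L g → Span L (f ⊕ g) → f ≡ g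
    irreducible-unique {f} {g} p q fg∈ with LT σ (f ⊕ g) in lt
    ... | nothing = ⊕≡𝟘⇒≡ (LT-nothing (f ⊕ g) lt)
    ... | just t with LT-Span L d fg∈ lt
    ...   | l , l∈L , lt-l = contradiction lt-l (irreducible-LT (f ⊕ g) (irreducible-⊕ f g p q) lt l∈L)

    -- If 1 is irreducible, then division only ever subtracts elements of L.
    NR-Span : Irreducible L 𝟙 → ∀ f → Span L (f ⊕ NR σ f L)
    NR-Span irr-𝟙 = NR-mod zero Span-⊕ λ {t} {l} {m} l∈L mult → member l∈L (multiple-just {t} {l} mult)
      where
      member : ∀ {t l m} → l ∈ L → (l ≡ 𝟙 × m ≡ term t) ⊎ (LT σ l ≡ just t × m ≡ l) → Span L m
      member l∈L (inj₂ (_ , refl)) = ∈⇒Span l∈L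
      member l∈L (inj₁ (refl , _)) = contradiction LT-𝟙 (irreducible-LT 𝟙 irr-𝟙 LT-𝟙 l∈L)
        where
        LT-𝟙 : LT σ 𝟙 ≡ just zero
        LT-𝟙 = IsLead⇒LT 𝟙 (IsLead-term zero)

    -- Both sides are irreducible and congruent to `f ⊕ 𝟙` modulo `Span L`.
    NR-⊕𝟙 : Irreducible L 𝟙 → ∀ f → NR σ (f ⊕ 𝟙) L ≡ NR σ f L ⊕ 𝟙
    NR-⊕𝟙 irr-𝟙 f = irreducible-unique (NR-irreducible (f ⊕ 𝟙) L)
      (irreducible-⊕ (NR σ f L) 𝟙 (NR-irreducible f L) irr-𝟙)
      (subst (Span L) eq (Span-⊕ (NR-Span irr-𝟙 (f ⊕ 𝟙)) (NR-Span irr-𝟙 f)))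
      where
      a = NR σ f L
      b = NR σ (f ⊕ 𝟙) L
      eq : ((f ⊕ 𝟙) ⊕ b) ⊕ (f ⊕ a) ≡ b ⊕ (a ⊕ 𝟙)
      eq = begin
        ((f ⊕ 𝟙) ⊕ b) ⊕ (f ⊕ a) ≡⟨ cong (_⊕ (f ⊕ a)) (⊕-assoc f 𝟙 b) ⟩
        (f ⊕ (𝟙 ⊕ b)) ⊕ (f ⊕ a) ≡⟨ ⊕-interchange f (𝟙 ⊕ b) f a ⟩
        (f ⊕ f) ⊕ ((𝟙 ⊕ b) ⊕ a) ≡⟨ cong (_⊕ ((𝟙 ⊕ b) ⊕ a)) (⊕-self f) ⟩
        𝟘 ⊕ ((𝟙 ⊕ b) ⊕ a)       ≡⟨ ⊕-identityˡ _ ⟩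
        (𝟙 ⊕ b) ⊕ a             ≡⟨ cong (_⊕ a) (⊕-comm 𝟙 b) ⟩
        (b ⊕ 𝟙) ⊕ a             ≡⟨ ⊕-assoc b 𝟙 a ⟩
        b ⊕ (𝟙 ⊕ a)             ≡⟨ cong (b ⊕_) (⊕-comm 𝟙 a) ⟩
        b ⊕ (a ⊕ 𝟙)             ∎
        where open ≡-Reasoning

  -- Existence of interreductions.

  IsLeadingTerm : List (𝕃 n) → 𝕋 n → Set
  IsLeadingTerm L t = ∃[ l ] l ∈ L × LT σ l ≡ just t

  leadingTerm? : ∀ L → Decidable (IsLeadingTerm L)
  leadingTerm? L t with any? (λ l → Maybe.≡-dec Fin._≟_ (LT σ l) (just t)) L
  ... | yes p = yes (find p)
  ... | no ¬p = no λ (l , l∈L , lt) → ¬p (lose l∈L lt)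

  -- Clears only the leading term, since distinctness asks no more, and each time with an element of
  -- `L` that has this leading term. Unlike `divide`, it thus stays within the span even if `𝟙 ∈ L`.
  reduceLT : ∀ L k f → Below k f → ∃[ r ] Span L (f ⊕ r) × (∀ {t} → LT σ r ≡ just t → ¬ IsLeadingTerm L t)
  reduceLT L k f below with LT σ f in lt
  ... | nothing = f , subst (Span L) (sym (⊕-self f)) zero , λ lt′ → contradiction (trans (sym lt) lt′) λ ()
  reduceLT L zero f below | just t = contradiction (below refl) λ ()
  reduceLT L (suc k) f below | just t with leadingTerm? L t
  ... | no ¬p = f , subst (Span L) (sym (⊕-self f)) zero ,
                λ lt′ → subst (¬_ ∘ IsLeadingTerm L) (Maybe.just-injective (trans (sym lt) lt′)) ¬p
  ... | yes (l , l∈L , lt-l)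
    with reduceLT L k (f ⊕ l) (below-⊕ {f = f} (λ e → below (trans (sym lt) e)) lt (LT-just l lt-l))
  ...   | r , flr∈ , p = r , subst (Span L) eq (add l∈L flr∈) , p
    where
    eq : l ⊕ ((f ⊕ l) ⊕ r) ≡ f ⊕ r
    eq = trans (cong (λ h → l ⊕ (h ⊕ r)) (⊕-comm f l))
      (trans (cong (l ⊕_) (⊕-assoc l f r)) (⊕-cancelˡ l (f ⊕ r)))

  -- Gaussian elimination, one generator at a time; it ensures that an `interreduce` state is never
  -- stuck.
  interreduction : ∀ L → ∃[ L′ ] IsInterreductionOf σ L′ L
  interreduction [] = [] , (id , id) , (λ _ ()) , (λ _ _ ())
  interreduction (f ∷ L) with interreduction L
  ... | L′ , (L′⊆L , L⊆L′) , d@(nonzero , distinct) with reduceLT L′ (suc n) f (below-𝕃 f)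
  ...   | r , fr∈ , new with r ≟ 𝟘
  ...     | yes refl = L′ , (Span-mono L′⊆fL , Span-mono fL⊆L′) , d
    where
    L′⊆fL : ∀ {l} → l ∈ L′ → Span (f ∷ L) l
    L′⊆fL l∈ = Span-mono (∈⇒Span ∘ there) (L′⊆L (∈⇒Span l∈))
    fL⊆L′ : ∀ {l} → l ∈ f ∷ L → Span L′ l
    fL⊆L′ (here refl) = subst (Span L′) (⊕-identityʳ f) fr∈
    fL⊆L′ (there l∈)  = L⊆L′ (∈⇒Span l∈)
  ...     | no r≢𝟘 = r ∷ L′ , (Span-mono rL′⊆fL , Span-mono fL⊆rL′) , nonzero′ , distinct′
    where
    rL′⊆fL : ∀ {l} → l ∈ r ∷ L′ → Span (f ∷ L) l
    rL′⊆fL (here refl) = subst (Span (f ∷ L)) (⊕-cancelˡ f r)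
      (add (here refl) (Span-mono (∈⇒Span ∘ there) (L′⊆L fr∈)))
    rL′⊆fL (there l∈)  = Span-mono (∈⇒Span ∘ there) (L′⊆L (∈⇒Span l∈))
    fL⊆rL′ : ∀ {l} → l ∈ f ∷ L → Span (r ∷ L′) l
    fL⊆rL′ (here refl) = subst (Span (r ∷ L′)) (trans (⊕-comm r _) (⊕-cancelʳ f r))
      (add (here refl) (Span-mono (∈⇒Span ∘ there) fr∈))
    fL⊆rL′ (there l∈)  = Span-mono (∈⇒Span ∘ there) (L⊆L′ (∈⇒Span l∈))
    nonzero′ : ∀ g → g ∈ r ∷ L′ → g ≢ 𝟘
    nonzero′ g (here refl) = r≢𝟘
    nonzero′ g (there g∈)  = nonzero g g∈
    clash : ∀ {g} → g ∈ L′ → LT σ r ≢ LT σ g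
    clash g∈ eq = let t , lt = LT-defined r≢𝟘 in new lt (_ , g∈ , trans (sym eq) lt)
    distinct′ : ∀ g h → g ∈ r ∷ L′ → h ∈ r ∷ L′ → LT σ g ≡ LT σ h → g ≡ h
    distinct′ g h (here refl) (here refl) _  = refl
    distinct′ g h (here refl) (there h∈)  eq = contradiction eq (clash h∈)
    distinct′ g h (there g∈)  (here refl) eq = contradiction (sym eq) (clash g∈)
    distinct′ g h (there g∈)  (there h∈)  eq = distinct g h g∈ h∈ eq

  -- What a pass adds to the graph.

  module _ (L₀ : List (𝕃 n)) where

    -- With remainders taken modulo the fixed `L₀`, the contribution of an edge is independent of
    -- the accumulator, and the fold becomes a concatenation.
    emit : 𝕃 n × 𝕃 n → Graph n
    emit = processEdge σ L₀ ⟨ [] , [] , [] ⟩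

    private
      step : Graph n → 𝕃 n × 𝕃 n → Graph n
      step = processEdge σ L₀

    foldl-L : ∀ H es → L (foldl step H es) ≡ L H ++ concatMap (L ∘ emit) es
    foldl-L H []       = sym (++-identityʳ (L H))
    foldl-L H (e ∷ es) = trans (foldl-L (step H e) es)
      (trans (cong (_++ concatMap (L ∘ emit) es) (++-assoc (L H) _ _)) (++-assoc (L H) _ _))

    foldl-V : ∀ H es → V (foldl step H es) ≡ V H ++ concatMap (V ∘ emit) es
    foldl-V H []       = sym (++-identityʳ (V H))
    foldl-V H (e ∷ es) = trans (foldl-V (step H e) es) (++-assoc (V H) _ _)

    foldl-E : ∀ H es → E (foldl step H es) ≡ E H ++ concatMap (E ∘ emit) es
    foldl-E H []       = sym (++-identityʳ (E H))
    foldl-E H (e ∷ es) = trans (foldl-E (step H e) es) (++-assoc (E H) _ _)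

  -- The edge `(f , g)` stands for the generator `(f + 1) g`, that is, `f = 0` implies `g = 0` at
  -- every zero. These are the two unit propagations: the antecedent holds identically, or the
  -- consequent never does.
  data Propagated : (f g l : 𝕃 n) → Set where
    consequent : ∀ {f g} → f ≡ 𝟘 → g ≢ 𝟘 → Propagated f g g
    antecedent : ∀ {f g} → g ≡ 𝟙 → f ≢ 𝟙 → Propagated f g (f ⊕ 𝟙)

  Constant : 𝕃 n → Set
  Constant f = f ≡ 𝟘 ⊎ f ≡ 𝟙

  Kept : (f g : 𝕃 n) → Set
  Kept f g = ¬ Constant f × ¬ Constant g × f ≢ g

  module _ (G : Graph n) where

    nr : 𝕃 n → 𝕃 n
    nr f = NR σ f (L G)

    -- Spelled exactly as the test in `processEdge`, so that its conditional matches by definition;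
    -- likewise for `antecedent?` and `kept?`.
    consequent? : (f g : 𝕃 n) → Dec (f ≡ 𝟘 × g ≢ 𝟘)
    consequent? f g = (f ≟ 𝟘) ×-dec ¬? (g ≟ 𝟘)

    antecedent? : (f g : 𝕃 n) → Dec (g ≡ 𝟙 × f ≢ 𝟙)
    antecedent? f g = (g ≟ 𝟙) ×-dec ¬? (f ≟ 𝟙)

    ∈L-pass⁺ˡ : ∀ {l} → l ∈ L G → l ∈ L (pass σ G)
    ∈L-pass⁺ˡ l∈ = subst (_ ∈_) (sym (foldl-L (L G) _ (E G))) (∈-++⁺ˡ l∈)

    ∈L-pass⁺ʳ : ∀ {f g l} → (f , g) ∈ E G → Propagated (nr f) (nr g) l → l ∈ L (pass σ G)
    ∈L-pass⁺ʳ {f} {g} {l} fg∈ p = subst (_ ∈_) (sym (foldl-L (L G) _ (E G)))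
      (∈-++⁺ʳ (L G) (∈-concatMap⁺ (L ∘ emit (L G)) (lose fg∈ (emitted p))))
      where
      emitted : Propagated (nr f) (nr g) l → l ∈ L (emit (L G) (f , g))
      emitted (consequent f≡𝟘 g≢𝟘) = ∈-++⁺ˡ (∈-if⁺ (consequent? (nr f) (nr g)) (f≡𝟘 , g≢𝟘) (here refl))
      emitted (antecedent g≡𝟙 f≢𝟙) = ∈-++⁺ʳ (if ⌊ consequent? (nr f) (nr g) ⌋ then [ nr g ] else [])
        (∈-if⁺ (antecedent? (nr f) (nr g)) (g≡𝟙 , f≢𝟙) (here refl))

    ∈L-pass⁻ : ∀ {l} → l ∈ L (pass σ G) →
               l ∈ L G ⊎ ∃[ f ] ∃[ g ] (f , g) ∈ E G × Propagated (nr f) (nr g) l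
    ∈L-pass⁻ {l} l∈ with ∈-++⁻ (L G) (subst (l ∈_) (foldl-L (L G) _ (E G)) l∈)
    ... | inj₁ l∈L = inj₁ l∈L
    ... | inj₂ l∈′ with find (∈-concatMap⁻ (L ∘ emit (L G)) {xs = E G} l∈′)
    ...   | (f , g) , fg∈ , l∈emit = inj₂ (f , g , fg∈ ,
      emitted (∈-++⁻ (if ⌊ consequent? (nr f) (nr g) ⌋ then [ nr g ] else []) l∈emit))
      where
      emitted : l ∈ (if ⌊ consequent? (nr f) (nr g) ⌋ then [ nr g ] else [])
              ⊎ l ∈ (if ⌊ antecedent? (nr f) (nr g) ⌋ then [ nr f ⊕ 𝟙 ] else []) →
              Propagated (nr f) (nr g) l
      emitted (inj₁ l∈) with ∈-if⁻ (consequent? (nr f) (nr g)) l∈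
      ... | (f≡𝟘 , g≢𝟘) , here refl = consequent f≡𝟘 g≢𝟘
      emitted (inj₂ l∈) with ∈-if⁻ (antecedent? (nr f) (nr g)) l∈
      ... | (g≡𝟙 , f≢𝟙) , here refl = antecedent g≡𝟙 f≢𝟙

    constant? : Decidable Constant
    constant? h = (h ≟ 𝟘) ⊎-dec (h ≟ 𝟙)

    kept? : ∀ f g → Dec (Kept f g)
    kept? f g = ¬? (constant? f) ×-dec ¬? (constant? g) ×-dec ¬? (f ≟ g)

    ∈E-pass⁺ : ∀ {f g} → (f , g) ∈ E G → Kept (nr f) (nr g) → (nr f , nr g) ∈ E (pass σ G)
    ∈E-pass⁺ {f} {g} fg∈ kept = subst ((nr f , nr g) ∈_) (sym (foldl-E (L G) _ (E G)))
      (∈-concatMap⁺ (E ∘ emit (L G)) (lose fg∈ (∈-if⁺ (kept? (nr f) (nr g)) kept (here refl))))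

    ∈E-pass⁻ : ∀ {e} → e ∈ E (pass σ G) →
               ∃[ f ] ∃[ g ] (f , g) ∈ E G × Kept (nr f) (nr g) × e ≡ (nr f , nr g)
    ∈E-pass⁻ {e} e∈ with find (∈-concatMap⁻ (E ∘ emit (L G)) {xs = E G} (subst (e ∈_) (foldl-E (L G) _ (E G)) e∈))
    ... | (f , g) , fg∈ , e∈emit with ∈-if⁻ (kept? (nr f) (nr g)) e∈emit
    ...   | kept , here refl = f , g , fg∈ , kept , refl

    ∈V-pass⁺ : ∀ {f g} → (f , g) ∈ E G → Kept (nr f) (nr g) → nr f ∈ V (pass σ G) × nr g ∈ V (pass σ G)
    ∈V-pass⁺ {f} {g} fg∈ kept = member (here refl) , member (there (here refl))
      where
      member : ∀ {h} → h ∈ nr f ∷ nr g ∷ [] → h ∈ V (pass σ G)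
      member h∈ = subst (_ ∈_) (sym (foldl-V (L G) _ (E G)))
        (∈-concatMap⁺ (V ∘ emit (L G)) (lose fg∈ (∈-if⁺ (kept? (nr f) (nr g)) kept h∈)))

    ∈V-pass⁻ : ∀ {h} → h ∈ V (pass σ G) → ∃[ f ] ∃[ g ] (f , g) ∈ E G × (h ≡ nr f ⊎ h ≡ nr g)
    ∈V-pass⁻ {h} h∈ with find (∈-concatMap⁻ (V ∘ emit (L G)) {xs = E G} (subst (h ∈_) (foldl-V (L G) _ (E G)) h∈))
    ... | (f , g) , fg∈ , h∈emit with ∈-if⁻ (kept? (nr f) (nr g)) h∈emit
    ...   | _ , here refl         = f , g , fg∈ , inj₁ refl
    ...   | _ , there (here refl) = f , g , fg∈ , inj₂ refl

    propagated-irreducible : ∀ {f g l} → Propagated (nr f) (nr g) l → Irreducible (L G) l × l ≢ 𝟘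
    propagated-irreducible {g = g} (consequent _ g≢𝟘) = NR-irreducible g (L G) , g≢𝟘
    -- Here `𝟙` is itself the remainder of `g`, hence irreducible, and so is its sum with `nr f`.
    propagated-irreducible {f} {g} (antecedent g≡𝟙 f≢𝟙) =
      irreducible-⊕ (nr f) 𝟙 (NR-irreducible f (L G)) (subst (Irreducible (L G)) g≡𝟙 (NR-irreducible g (L G)))
      , f≢𝟙 ∘ ⊕≡𝟘⇒≡

  -- Termination and progress.

  -- The set of terms that lead no element of K shrinks whenever an irreducible polynomial is adjoined;
  -- it is an invariant of the span, so it is the same for every interreduction.
  free? : ∀ K → Decidable (λ t → ¬ IsLeadingTerm K t)
  free? K t = ¬? (leadingTerm? K t)

  free : List (𝕃 n) → Subset (suc n)
  free K = subset (free? K)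

  module _ {K K′ : List (𝕃 n)} (d : DistinctLT σ K) (d′ : DistinctLT σ K′)
           (K⊆ : ∀ {l} → l ∈ K → Span K′ l) where

    -- The leading term of `f` witnesses strictness: free for `K` by irreducibility, but not for
    -- `K′`.
    free-⊂ : ∀ {f} → Span K′ f → Irreducible K f → f ≢ 𝟘 → free K′ ⊂ free K
    free-⊂ {f} f∈ irr f≢𝟘 with LT-defined f≢𝟘
    ... | t , lt = subset-⊂ (free? K′) (free? K)
      (λ t-free (l , l∈K , lt-l) → t-free (LT-Span K′ d′ (K⊆ l∈K) lt-l))
      (λ (l , l∈K , lt-l) → irreducible-LT f irr lt l∈K lt-l)
      (λ t-free → t-free (LT-Span K′ d′ f∈ lt))

  Span-L⊆Span-L-pass : ∀ G → Span (L G) ⊆ Span (L (pass σ G))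
  Span-L⊆Span-L-pass G = Span-mono (λ l∈ → ∈⇒Span (∈L-pass⁺ˡ G l∈))

  -- The rule `changed` offers only a negation; deciding membership turns it into an actual new
  -- element. The other inclusion is automatic, as a pass only appends.
  settled? : ∀ G → L G ∼[ set ] L (pass σ G) ⊎ ∃[ l ] l ∈ L (pass σ G) × l ∉ L G
  settled? G with any? (λ l → ¬? (l ∈? L G)) (L (pass σ G))
  ... | yes p = inj₂ (find p)
  ... | no ¬p = inj₁ (mk⇔ (∈L-pass⁺ˡ G) λ l∈ → decidable-stable (_ ∈? L G) (λ l∉ → ¬p (lose l∈ l∉)))

  -- The measure is compared across two transitions, `changed` and the interreduction after it,
  -- because the list in between may have coinciding leading terms.
  loop-accessible : ∀ G → DistinctLT σ (L G) → Acc _⊂_ (free (L G)) → Acc (flip (_⟶_ σ)) (loop G)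
  loop-accessible G d (acc rs) = acc λ
    { (unchanged _)  → acc λ ()
    ; (changed ¬set) → acc λ { (interreduced ((_ , ⊆L₁) , d₁)) → loop-accessible _ d₁ (rs (smaller ¬set ⊆L₁ d₁)) }
    }
    where
    smaller : ∀ {L₁} → ¬ (L G ∼[ set ] L (pass σ G)) → Span (L (pass σ G)) ⊆ Span L₁ → DistinctLT σ L₁ →
              free L₁ ⊂ free (L G)
    smaller ¬set ⊆L₁ d₁ with settled? G
    ... | inj₁ eq = ⊥-elim (¬set eq)
    ... | inj₂ (l , l∈ , l∉) with ∈L-pass⁻ G l∈
    ...   | inj₁ l∈L = contradiction l∈L l∉
    ...   | inj₂ (f , g , _ , p) with propagated-irreducible G {f} {g} p
    ...     | irr , l≢𝟘 = free-⊂ d d₁ (⊆L₁ ∘ Span-L⊆Span-L-pass G ∘ ∈⇒Span) (⊆L₁ (∈⇒Span l∈)) irr l≢𝟘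

  terminates : ∀ G → Acc (flip (_⟶_ σ)) (interreduce G)
  terminates G = acc λ { (interreduced (_ , d)) → loop-accessible _ d (Subset.⊂-wellFounded _) }

  -- Accessibility only rules out infinite runs; this rules out runs stuck before `return`.
  progress : ∀ s → (∃[ G ] s ≡ return G) ⊎ (∃[ s′ ] _⟶_ σ s s′)
  progress (return G)      = inj₁ (G , refl)
  progress (interreduce G) = inj₂ (_ , interreduced (proj₂ (interreduction (L G))))
  progress (loop G) with settled? G
  ... | inj₁ eq            = inj₂ (_ , unchanged eq)
  ... | inj₂ (l , l∈ , l∉) = inj₂ (_ , changed (λ eq → l∉ (Equivalence.from eq l∈)))

-- Sums of ideals and Boolean arithmetic.

module _ (R : CommutativeRing 0ℓ 0ℓ) where

  open CommutativeRing R renaming (refl to ≈-refl; sym to ≈-sym; trans to ≈-trans)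
  open CommutativeSemigroupProperties +-commutativeSemigroup using (interchange)

  Generated-least : ∀ {S K : Pred Carrier 0ℓ} → IsIdeal R K → S ⊆ K → Generated R S ⊆ K
  Generated-least K S⊆K (gen s)        = S⊆K s
  Generated-least K S⊆K (resp f≈g p)   = IsIdeal.resp K f≈g (Generated-least K S⊆K p)
  Generated-least K S⊆K 0-closed       = IsIdeal.0-closed K
  Generated-least K S⊆K (+-closed p q) = IsIdeal.+-closed K (Generated-least K S⊆K p) (Generated-least K S⊆K q)
  Generated-least K S⊆K (*-closed f p) = IsIdeal.*-closed K f (Generated-least K S⊆K p)

  module _ {S T : Pred Carrier 0ℓ} where

    private
      Sum-ST = IdealSum R (Generated R S) (Generated R T)

    IdealSum-isIdeal : IsIdeal R Sum-ST
    IdealSum-isIdeal = record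
      { resp     = λ f≈g (a , b , p , q , eq) → a , b , p , q , ≈-trans (≈-sym f≈g) eq
      ; 0-closed = 0# , 0# , 0-closed , 0-closed , ≈-sym (+-identityˡ 0#)
      ; +-closed = λ (a , b , p , q , eq) (a′ , b′ , p′ , q′ , eq′) →
          a + a′ , b + b′ , +-closed p p′ , +-closed q q′ , ≈-trans (+-cong eq eq′) (interchange a b a′ b′)
      ; *-closed = λ f (a , b , p , q , eq) →
          f * a , f * b , *-closed f p , *-closed f q , ≈-trans (*-congˡ eq) (distribˡ f a b)
      }

    IdealSum-⊇ˡ : S ⊆ Sum-ST
    IdealSum-⊇ˡ {f} s = f , 0# , gen s , 0-closed , ≈-sym (+-identityʳ f)

    IdealSum-⊇ʳ : T ⊆ Sum-ST
    IdealSum-⊇ʳ {f} t = 0# , f , 0-closed , gen t , ≈-sym (+-identityˡ f)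

    IdealSum-least : ∀ {K} → IsIdeal R K → S ⊆ K → T ⊆ K → Sum-ST ⊆ K
    IdealSum-least K S⊆K T⊆K (_ , _ , p , q , eq) = IsIdeal.resp K (≈-sym eq)
      (IsIdeal.+-closed K (Generated-least K S⊆K p) (Generated-least K T⊆K q))

𝔹-char2 : ∀ n → let open CommutativeRing (𝔹 n) in ∀ x → x + x ≈ 0#
𝔹-char2 zero    x       = Bool.xor-same x
𝔹-char2 (suc n) (g , h) = 𝔹-char2 n g , 𝔹-char2 n h

𝔹-idem : ∀ n → let open CommutativeRing (𝔹 n) in ∀ x → x * x ≈ x
𝔹-idem zero    x       = Bool.∧-idem x
𝔹-idem (suc n) (g , h) = 𝔹-idem n g , (begin
  (g * h + h * g) + h * h ≈⟨ +-cong (+-congˡ (*-comm h g)) (𝔹-idem n h) ⟩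
  (g * h + g * h) + h     ≈⟨ +-congʳ (𝔹-char2 n (g * h)) ⟩
  0# + h                  ≈⟨ +-identityˡ h ⟩
  h                       ∎)
  where
  open CommutativeRing (𝔹 n)
  open SetoidReasoning setoid

-- The embedding of linear polynomials and the ideal of a graph.

module _ {n : ℕ} where

  open CommutativeRing (𝔹 n) renaming (refl to ≈-refl; sym to ≈-sym; trans to ≈-trans)
  open Sum +-commutativeMonoid using (sum; ∑-distrib-+; sum-cong-≋)
  open CommutativeSemigroupProperties +-commutativeSemigroup using (interchange)
  open SetoidReasoning setoid

  if-xor : ∀ b c x → (if b xor c then x else 0#) ≈ (if b then x else 0#) + (if c then x else 0#)
  if-xor false c     x = ≈-sym (+-identityˡ _)
  if-xor true  false x = ≈-sym (+-identityʳ x)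
  if-xor true  true  x = ≈-sym (𝔹-char2 n x)

  ι-⊕ : (f g : 𝕃 n) → ι (f ⊕ g) ≈ ι f + ι g
  ι-⊕ (c ∷ cs) (d ∷ ds) = begin
    (if c xor d then 1# else 0#) + sum (λ i → if lookup (zipWith _xor_ cs ds) i then var i else 0#)
      ≈⟨ +-cong (if-xor c d 1#) (≈-trans (sum-cong-≋ coefficient)
           (∑-distrib-+ (λ i → if lookup cs i then var i else 0#) (λ i → if lookup ds i then var i else 0#))) ⟩
    ((if c then 1# else 0#) + (if d then 1# else 0#)) + _
      ≈⟨ interchange _ _ _ _ ⟩
    ι (c ∷ cs) + ι (d ∷ ds) ∎
    where
    coefficient : ∀ i → (if lookup (zipWith _xor_ cs ds) i then var i else 0#) ≈
                        (if lookup cs i then var i else 0#) + (if lookup ds i then var i else 0#)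
    coefficient i rewrite Vec.lookup-zipWith _xor_ i cs ds = if-xor (lookup cs i) (lookup ds i) (var i)

  -- Additivity and characteristic 2 give `ι 𝟘 = ι 𝟘 + ι 𝟘 = 0` without evaluating the sum over the
  -- variables.
  ι-𝟘 : ι (𝟘 {n}) ≈ 0#
  ι-𝟘 = begin
    ι (𝟘 {n})             ≡⟨ cong (ι {n}) (⊕-self 𝟘) ⟨
    ι (𝟘 {n} ⊕ 𝟘)         ≈⟨ ι-⊕ 𝟘 𝟘 ⟩
    ι (𝟘 {n}) + ι (𝟘 {n}) ≈⟨ 𝔹-char2 n (ι (𝟘 {n})) ⟩
    0#                    ∎

  -- `𝟙` and `𝟘` share their variable part, whose sum vanishes by `ι-𝟘`.
  ι-𝟙 : ι (𝟙 {n}) ≈ 1#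
  ι-𝟙 = ≈-trans (+-congˡ (≈-trans (≈-sym (+-identityˡ _)) ι-𝟘)) (+-identityʳ 1#)

  module _ {K : Pred Carrier 0ℓ} (K-ideal : IsIdeal (𝔹 n) K) where

    private
      module K = IsIdeal K-ideal

    ideal-ι-𝟘 : K (ι (𝟘 {n}))
    ideal-ι-𝟘 = K.resp (≈-sym ι-𝟘) K.0-closed

    ideal-ι-⊕ : ∀ {f g} → K (ι f) → K (ι g) → K (ι (f ⊕ g))
    ideal-ι-⊕ {f} {g} p q = K.resp (≈-sym (ι-⊕ f g)) (K.+-closed p q)

    ideal-𝟙 : K (ι (𝟙 {n})) → ∀ x → K x
    ideal-𝟙 p x = K.resp (≈-trans (*-congˡ ι-𝟙) (*-identityʳ x)) (K.*-closed x p)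

    -- Rests on `(f′ + 1) g′ = (f + 1) g + (f + 1)(g + g′) + (f + f′) g′`, valid in characteristic
    -- 2.
    ideal-clause : ∀ {f f′ g g′} → K (ι (f ⊕ f′)) → K (ι (g ⊕ g′)) →
                   K (ι (f ⊕ 𝟙) * ι g) → K (ι (f′ ⊕ 𝟙) * ι g′)
    ideal-clause {f} {f′} {g} {g′} u w p = K.resp (≈-sym eq)
      (K.+-closed (K.+-closed p (K.*-closed _ w)) (K.resp (*-comm _ _) (K.*-closed _ u)))
      where
      f′≡ : f′ ⊕ 𝟙 ≡ (f ⊕ 𝟙) ⊕ (f ⊕ f′)
      f′≡ = trans (⊕-comm f′ 𝟙) (trans (cong (𝟙 ⊕_) (sym (⊕-cancelˡ f f′)))
        (trans (sym (⊕-assoc 𝟙 f (f ⊕ f′))) (cong (_⊕ (f ⊕ f′)) (⊕-comm 𝟙 f))))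
      eq : ι (f′ ⊕ 𝟙) * ι g′ ≈ (ι (f ⊕ 𝟙) * ι g + ι (f ⊕ 𝟙) * ι (g ⊕ g′)) + ι (f ⊕ f′) * ι g′
      eq = begin
        ι (f′ ⊕ 𝟙) * ι g′
          ≡⟨ cong (λ h → ι h * ι g′) f′≡ ⟩
        ι ((f ⊕ 𝟙) ⊕ (f ⊕ f′)) * ι g′
          ≈⟨ *-congʳ (ι-⊕ (f ⊕ 𝟙) (f ⊕ f′)) ⟩
        (ι (f ⊕ 𝟙) + ι (f ⊕ f′)) * ι g′
          ≈⟨ distribʳ _ _ _ ⟩
        ι (f ⊕ 𝟙) * ι g′ + ι (f ⊕ f′) * ι g′
          ≡⟨ cong (λ h → ι (f ⊕ 𝟙) * ι h + ι (f ⊕ f′) * ι g′) (⊕-cancelˡ g g′) ⟨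
        ι (f ⊕ 𝟙) * ι (g ⊕ (g ⊕ g′)) + ι (f ⊕ f′) * ι g′
          ≈⟨ +-congʳ (≈-trans (*-congˡ (ι-⊕ g (g ⊕ g′))) (distribˡ _ _ _)) ⟩
        (ι (f ⊕ 𝟙) * ι g + ι (f ⊕ 𝟙) * ι (g ⊕ g′)) + ι (f ⊕ f′) * ι g′ ∎

  -- Tests generators instead of ideals: two graphs have the same ideal once every ideal contains
  -- the generators of one exactly when it contains those of the other. Indexing by the stored edge
  -- `(f , g)` is harmless, as adding 1 is an involution.
  record Contains (K : Pred Carrier 0ℓ) (G : Graph n) : Set where
    field
      linear : ∀ {l} → l ∈ L G → K (ι l)
      clause : ∀ {f g} → (f , g) ∈ E G → K (ι (f ⊕ 𝟙) * ι g)

  graphIdeal : Graph n → Pred Carrier 0ℓ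
  graphIdeal G = IdealSum (𝔹 n) (Generated (𝔹 n) (linearPart G)) (Generated (𝔹 n) (edgePart G))

  graphIdeal-contains : ∀ G → Contains (graphIdeal G) G
  graphIdeal-contains G = record
    { linear = λ {l} l∈ → IdealSum-⊇ˡ (𝔹 n) (l , l∈ , refl)
    ; clause = λ {f} {g} fg∈ → IdealSum-⊇ʳ (𝔹 n)
        (f ⊕ 𝟙 , g , subst (λ h → (h , g) ∈ E G) (sym (⊕-cancelʳ f 𝟙)) fg∈ , refl)
    }

  graphIdeal-least : ∀ {K} G → IsIdeal (𝔹 n) K → Contains K G → graphIdeal G ⊆ K
  graphIdeal-least {K} G K-ideal c = IdealSum-least (𝔹 n) K-ideal
    (λ { (l , l∈ , refl) → Contains.linear c l∈ })
    (λ { (f , g , fg∈ , refl) → subst (λ h → K (ι h * ι g)) (⊕-cancelʳ f 𝟙) (Contains.clause c fg∈) })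

  -- The ideal of `H` itself is taken as the test ideal `K`.
  graphIdeal-⊆ : ∀ G H → (∀ {K} → IsIdeal (𝔹 n) K → Contains K H → Contains K G) → graphIdeal G ⊆ graphIdeal H
  graphIdeal-⊆ G H H⇒G = graphIdeal-least G (IdealSum-isIdeal (𝔹 n))
    (H⇒G (IdealSum-isIdeal (𝔹 n)) (graphIdeal-contains H))

  represents-cong : ∀ {I : Pred Carrier 0ℓ} G H →
    (∀ {K} → IsIdeal (𝔹 n) K → Contains K G → Contains K H) →
    (∀ {K} → IsIdeal (𝔹 n) K → Contains K H → Contains K G) →
    I ≐ graphIdeal G → I ≐ graphIdeal H
  represents-cong G H G⇒H H⇒G (I⊆ , ⊆I) = graphIdeal-⊆ G H H⇒G ∘ I⊆ , ⊆I ∘ graphIdeal-⊆ H G G⇒H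

  ideal-Span : ∀ {K} → IsIdeal (𝔹 n) K → ∀ {J} → (∀ {l} → l ∈ J → K (ι l)) → ∀ {f} → Span J f → K (ι f)
  ideal-Span {K} K-ideal = Span-least {P = K ∘ ι} (ideal-ι-𝟘 K-ideal) (λ {f} {g} → ideal-ι-⊕ K-ideal {f} {g})

  IsIGS-Span : ∀ {I} {L₀ L₁ : List (𝕃 n)} {V₀ E₀} → Span L₁ ≐ Span L₀ →
               IsIGS I ⟨ L₀ , V₀ , E₀ ⟩ → IsIGS I ⟨ L₁ , V₀ , E₀ ⟩
  IsIGS-Span {L₀ = L₀} {L₁} {V₀} {E₀} (L₁⊆ , ⊆L₁) igs = record
    { E⊆V²           = IsIGS.E⊆V² igs
    ; represents     = represents-cong ⟨ L₀ , V₀ , E₀ ⟩ ⟨ L₁ , V₀ , E₀ ⟩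
        (transfer {L₀} {L₁} L₁⊆) (transfer {L₁} {L₀} ⊆L₁) (IsIGS.represents igs)
    ; contrapositive = IsIGS.contrapositive igs
    ; loopless       = IsIGS.loopless igs
    }
    where
    transfer : ∀ {J J′} → Span J′ ⊆ Span J → ∀ {K} → IsIdeal (𝔹 n) K →
               Contains K ⟨ J , V₀ , E₀ ⟩ → Contains K ⟨ J′ , V₀ , E₀ ⟩
    transfer J′⊆J K-ideal c = record
      { linear = λ l∈ → ideal-Span K-ideal (Contains.linear c) (J′⊆J (∈⇒Span l∈))
      ; clause = Contains.clause c
      }

-- One pass: ideal, contraposition, size and reducedness.

module _ {n} (σ : TermOrdering n) (G : Graph n) where

  open CommutativeRing (𝔹 n)
    using (_≈_; _+_; _*_; 0#; 1#; +-cong; *-congˡ; *-congʳ; *-comm; *-identityˡ; *-identityʳ; distribʳ; zeroˡ; zeroʳ; setoid)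
    renaming (sym to ≈-sym; trans to ≈-trans)
  private
    r = nr σ G

  module _ {K} (K-ideal : IsIdeal (𝔹 n) K) where

    private
      module K = IsIdeal K-ideal

    -- If `𝟙 ∈ L G`, a step may subtract any term, but then `K` is the whole ring.
    ideal-NR : (∀ {l} → l ∈ L G → K (ι l)) → ∀ f → K (ι (f ⊕ r f))
    ideal-NR K-L = NR-mod σ {P = K ∘ ι} (ideal-ι-𝟘 {n} K-ideal) (λ {f} {g} → ideal-ι-⊕ {n} K-ideal {f} {g})
      λ {t} {l} l∈L eq → member l∈L (multiple-just σ {t} {l} eq)
      where
      member : ∀ {t l m} → l ∈ L G → (l ≡ 𝟙 × m ≡ term t) ⊎ (LT σ l ≡ just t × m ≡ l) → K (ι m)
      member l∈L (inj₁ (refl , _)) = ideal-𝟙 {n} K-ideal (K-L l∈L) _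
      member l∈L (inj₂ (_ , refl)) = K-L l∈L

    propagated-vanishes : ∀ {f g l} → Propagated σ f g l → K (ι (f ⊕ 𝟙) * ι g) → K (ι l)
    propagated-vanishes {g = g} (consequent refl _) =
      K.resp (≈-trans (*-congʳ (subst (λ h → ι {n} h ≈ 1#) (sym (⊕-identityˡ 𝟙)) (ι-𝟙 {n}))) (*-identityˡ (ι g)))
    propagated-vanishes {f} (antecedent refl _) = K.resp (≈-trans (*-congˡ (ι-𝟙 {n})) (*-identityʳ _))

    -- The product is 0 if `g = 0`, if `f = 1`, or, by idempotence, if `f = g`; it is a multiple of
    -- `g` and of `f + 1`, which settles `f = 0` and `g = 1`. The order of the tests provides the
    -- side conditions of `Propagated`.
    clause-vanishes : ∀ f g → (∀ {l} → Propagated σ f g l → K (ι l)) →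
                      (Kept σ f g → K (ι (f ⊕ 𝟙) * ι g)) → K (ι (f ⊕ 𝟙) * ι g)
    clause-vanishes f g K-l K-fg with g ≟ 𝟘
    ... | yes refl = K.resp (≈-sym (≈-trans (*-congˡ (ι-𝟘 {n})) (zeroʳ _))) K.0-closed
    ... | no g≢𝟘 with f ≟ 𝟘
    ...   | yes f≡𝟘 = K.*-closed _ (K-l (consequent f≡𝟘 g≢𝟘))
    ...   | no f≢𝟘 with f ≟ 𝟙
    ...     | yes refl = K.resp
      (≈-sym (≈-trans (*-congʳ (subst (λ h → ι {n} h ≈ 0#) (sym (⊕-self 𝟙)) (ι-𝟘 {n}))) (zeroˡ _))) K.0-closed
    ...     | no f≢𝟙 with g ≟ 𝟙
    ...       | yes g≡𝟙 = K.resp (*-comm _ _) (K.*-closed _ (K-l (antecedent g≡𝟙 f≢𝟙)))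
    ...       | no g≢𝟙 with f ≟ g
    ...         | no f≢g   = K-fg ([ f≢𝟘 , f≢𝟙 ]′ , [ g≢𝟘 , g≢𝟙 ]′ , f≢g)
    ...         | yes refl = K.resp (≈-sym zero-product) K.0-closed
      where
      open SetoidReasoning setoid
      zero-product : ι (f ⊕ 𝟙) * ι f ≈ 0#
      zero-product = begin
        ι (f ⊕ 𝟙) * ι f             ≈⟨ *-congʳ (ι-⊕ f 𝟙) ⟩
        (ι f + ι (𝟙 {n})) * ι f     ≈⟨ distribʳ _ _ _ ⟩
        ι f * ι f + ι (𝟙 {n}) * ι f ≈⟨ +-cong (𝔹-idem n (ι f)) (≈-trans (*-congʳ (ι-𝟙 {n})) (*-identityˡ _)) ⟩
        ι f + ι f                   ≈⟨ 𝔹-char2 n (ι f) ⟩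
        0#                          ∎

    contains-pass : Contains K G → Contains K (pass σ G)
    contains-pass c = record
      { linear = λ l∈ → linear′ (∈L-pass⁻ σ G l∈)
      ; clause = λ fg∈ → clause′ (∈E-pass⁻ σ G fg∈)
      }
      where
      reduced : ∀ {f g} → (f , g) ∈ E G → K (ι (r f ⊕ 𝟙) * ι (r g))
      reduced {f} {g} fg∈ = ideal-clause K-ideal {f} {r f} {g} {r g}
        (ideal-NR (Contains.linear c) f) (ideal-NR (Contains.linear c) g) (Contains.clause c fg∈)
      linear′ : ∀ {l} → l ∈ L G ⊎ (∃[ f ] ∃[ g ] (f , g) ∈ E G × Propagated σ (r f) (r g) l) → K (ι l)
      linear′ (inj₁ l∈L)             = Contains.linear c l∈L
      linear′ (inj₂ (_ , _ , e∈ , p)) = propagated-vanishes p (reduced e∈)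
      clause′ : ∀ {a b} → ∃[ f ] ∃[ g ] (f , g) ∈ E G × Kept σ (r f) (r g) × (a , b) ≡ (r f , r g) →
                K (ι (a ⊕ 𝟙) * ι b)
      clause′ (_ , _ , e∈ , _ , refl) = reduced e∈

    pass-contains : Contains K (pass σ G) → Contains K G
    pass-contains c = record
      { linear = K-L
      ; clause = λ {f} {g} fg∈ → ideal-clause K-ideal {r f} {f} {r g} {g} (flipped f) (flipped g)
          (clause-vanishes (r f) (r g)
            (Contains.linear c ∘ ∈L-pass⁺ʳ σ G fg∈) (Contains.clause c ∘ ∈E-pass⁺ σ G fg∈))
      }
      where
      K-L : ∀ {l} → l ∈ L G → K (ι l)
      K-L = Contains.linear c ∘ ∈L-pass⁺ˡ σ G
      flipped : ∀ f → K (ι (r f ⊕ f))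
      flipped f = subst (K ∘ ι) (⊕-comm f (r f)) (ideal-NR K-L f)

  module _ (d : DistinctLT σ (L G)) {I} (igs : IsIGS I G) where

    pass-contrapositive : ∀ f g → (f ⊕ 𝟙 , g) ∈ E (pass σ G) → (g ⊕ 𝟙 , f) ∈ E (pass σ G)
    pass-contrapositive f g fg∈ with ∈E-pass⁻ σ G fg∈
    ... | a , b , ab∈ , (a-nc , b-nc , a≢b) , eq = subst (_∈ E (pass σ G))
      (cong₂ _,_ r-b⊕𝟙 r-a⊕𝟙)
      -- The old edge `(a , b)` has the partner `(b ⊕ 𝟙 , a ⊕ 𝟙)`, whose remainders `r b ⊕ 𝟙` and
      -- `r a ⊕ 𝟙` form the required edge.
      (∈E-pass⁺ σ G (IsIGS.contrapositive igs (a ⊕ 𝟙) b (subst (λ h → (h , b) ∈ E G) (sym (⊕-cancelʳ a 𝟙)) ab∈))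
        (subst (¬_ ∘ Constant σ) (sym r-b) (b-nc ∘ constant-⊕𝟙)
        , subst (¬_ ∘ Constant σ) (sym r-a) (a-nc ∘ constant-⊕𝟙)
        , λ eq′ → a≢b (⊕𝟙-injective (trans (sym r-a) (trans (sym eq′) r-b)))))
      where
      -- The remainder `r a` of a kept edge is the nonzero irreducible polynomial that forces 1 to
      -- be irreducible.
      irr-𝟙 : Irreducible σ (L G) 𝟙
      irr-𝟙 = irreducible-𝟙 σ (r a) (NR-irreducible σ a (L G)) (a-nc ∘ inj₁)
      r-a : r (a ⊕ 𝟙) ≡ r a ⊕ 𝟙
      r-a = NR-⊕𝟙 σ d irr-𝟙 a
      r-b : r (b ⊕ 𝟙) ≡ r b ⊕ 𝟙
      r-b = NR-⊕𝟙 σ d irr-𝟙 b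
      r-b⊕𝟙 : r (b ⊕ 𝟙) ≡ g ⊕ 𝟙
      r-b⊕𝟙 = trans r-b (cong (_⊕ 𝟙) (sym (cong proj₂ eq)))
      r-a⊕𝟙 : r (a ⊕ 𝟙) ≡ f
      r-a⊕𝟙 = trans r-a (trans (cong (_⊕ 𝟙) (sym (cong proj₁ eq))) (⊕-cancelʳ f 𝟙))
      ⊕𝟙-injective : ∀ {x y : 𝕃 n} → x ⊕ 𝟙 ≡ y ⊕ 𝟙 → x ≡ y
      ⊕𝟙-injective {x} {y} p = trans (sym (⊕-cancelʳ x 𝟙)) (trans (cong (_⊕ 𝟙) p) (⊕-cancelʳ y 𝟙))
      constant-⊕𝟙 : ∀ {x} → Constant σ (x ⊕ 𝟙) → Constant σ x
      constant-⊕𝟙 (inj₁ p) = inj₂ (⊕≡𝟘⇒≡ p)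
      constant-⊕𝟙 (inj₂ p) = inj₁ (⊕𝟙-injective (trans p (sym (⊕-identityˡ 𝟙))))

    pass-IsIGS : IsIGS I (pass σ G)
    pass-IsIGS = record
      { E⊆V²           = λ f g fg∈ → vertices (∈E-pass⁻ σ G fg∈)
      ; represents     = represents-cong G (pass σ G) contains-pass pass-contains (IsIGS.represents igs)
      ; contrapositive = pass-contrapositive
      ; loopless       = λ f _ ff∈ → no-loop (∈E-pass⁻ σ G ff∈)
      }
      where
      vertices : ∀ {a b} → ∃[ f ] ∃[ g ] (f , g) ∈ E G × Kept σ (r f) (r g) × (a , b) ≡ (r f , r g) →
                 a ∈ V (pass σ G) × b ∈ V (pass σ G)
      vertices (_ , _ , fg∈ , kept , refl) = ∈V-pass⁺ σ G fg∈ kept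
      no-loop : ∀ {a} → ¬ (∃[ f ] ∃[ g ] (f , g) ∈ E G × Kept σ (r f) (r g) × (a , a) ≡ (r f , r g))
      no-loop (_ , _ , _ , (_ , _ , f≢g) , eq) = f≢g (trans (sym (cong proj₁ eq)) (cong proj₂ eq))

    -- Each new vertex is the remainder of an endpoint of an old edge, hence of an old vertex.
    pass-≼ : pass σ G ≼ G
    pass-≼ = Span-L⊆Span-L-pass σ G , #-image r (λ h∈ → vertex (∈V-pass⁻ σ G h∈))
      where
      vertex : ∀ {h} → ∃[ f ] ∃[ g ] (f , g) ∈ E G × (h ≡ r f ⊎ h ≡ r g) → ∃[ v ] v ∈ V G × h ≡ r v
      vertex (f , g , fg∈ , inj₁ h≡) = f , proj₁ (IsIGS.E⊆V² igs f g fg∈) , h≡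
      vertex (f , g , fg∈ , inj₂ h≡) = g , proj₂ (IsIGS.E⊆V² igs f g fg∈) , h≡

  -- The new vertices are irreducible modulo the list that the pass started from; this carries over
  -- because the final list is the same set.
  pass-IsReduced : DistinctLT σ (L G) → L G ∼[ set ] L (pass σ G) → IsReduced σ (pass σ G)
  pass-IsReduced (nonzero , distinct) eq = record
    { distinctLT = (λ f f∈ → nonzero f (back f∈)) , (λ f g f∈ g∈ → distinct f g (back f∈) (back g∈))
    ; disjoint   = λ t l f l∈ lt f∈ t∈ → disjoint′ (back l∈) lt t∈ (∈V-pass⁻ σ G f∈)
    }
    where
    back : ∀ {l} → l ∈ L (pass σ G) → l ∈ L G
    back = Equivalence.from eq
    disjoint′ : ∀ {t l h} → l ∈ L G → LT σ l ≡ just t → t ∈Supp h →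
                ¬ (∃[ f ] ∃[ g ] (f , g) ∈ E G × (h ≡ r f ⊎ h ≡ r g))
    disjoint′ {t} {l} l∈ lt t∈ (f , g , _ , inj₁ refl) =
      multiple-nothing σ {t} {l} (NR-irreducible σ f (L G) t∈ l∈) lt
    disjoint′ {t} {l} l∈ lt t∈ (f , g , _ , inj₂ refl) =
      multiple-nothing σ {t} {l} (NR-irreducible σ g (L G) t∈ l∈) lt

≼-trans : ∀ {n} {G₁ G₂ G₃ : Graph n} → G₁ ≼ G₂ → G₂ ≼ G₃ → G₁ ≼ G₃
≼-trans (L₂⊆L₁ , V₁≤V₂) (L₃⊆L₂ , V₂≤V₃) = L₂⊆L₁ ∘ L₃⊆L₂ , ℕ.≤-trans V₁≤V₂ V₂≤V₃

-- The invariant of a run and the conclusion.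

module _ {n} (σ : TermOrdering n) (I : Pred (∣𝔹∣ n) 0ℓ) (G₀ : Graph n) where

  -- Distinct leading terms are recorded only in `loop` states, since a pass that appends may
  -- destroy them; the comparison is always with the input `G₀`.
  Invariant : State σ → Set
  Invariant (interreduce G) = IsIGS I G × G ≼ G₀
  Invariant (loop G)        = IsIGS I G × G ≼ G₀ × DistinctLT σ (L G)
  Invariant (return G)      = IsIGS I G × IsReduced σ G × G ≼ G₀

  Invariant-step : ∀ {s s′} → _⟶_ σ s s′ → Invariant s → Invariant s′
  Invariant-step (interreduced (span , d)) (igs , L₀⊆ , V≤) = IsIGS-Span span igs , (proj₂ span ∘ L₀⊆ , V≤) , d
  Invariant-step (changed {G} _) (igs , G≼G₀ , d) =
    pass-IsIGS σ G d igs , ≼-trans {G₁ = pass σ G} {G} {G₀} (pass-≼ σ G d igs) G≼G₀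
  Invariant-step (unchanged {G} eq) (igs , G≼G₀ , d) =
    pass-IsIGS σ G d igs , pass-IsReduced σ G d eq , ≼-trans {G₁ = pass σ G} {G} {G₀} (pass-≼ σ G d igs) G≼G₀

  Invariant-steps : ∀ {s s′} → _⟶*_ σ s s′ → Invariant s → Invariant s′
  Invariant-steps ε            inv = inv
  Invariant-steps (step ◅ steps) inv = Invariant-steps steps (Invariant-step step inv)

proposition4p8 : ∀ {n} (σ : TermOrdering n) (F : 2-XNF n) (I : Pred (∣𝔹∣ n) 0ℓ) → IsIdealOf F I →
    (G : Graph n) → IsIGS I G →
    Acc (flip (_⟶_ σ)) (interreduce G)
    × (∀ s → _⟶*_ σ (interreduce G) s → (∃[ G′ ] s ≡ return G′) ⊎ (∃[ s′ ] _⟶_ σ s s′))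
    × (∀ G′ → _⟶*_ σ (interreduce G) (return G′) → IsIGS I G′ × IsReduced σ G′ × G′ ≼ G)
proposition4p8 σ F I _ G igs =
  terminates σ G , (λ s _ → progress σ s) , λ G′ steps → Invariant-steps σ I G steps (igs , id , ℕ.≤-refl)
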